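{- Let $k\geq 4$ be an even integer and let $q$ denote the smallest prime power for which $k\leq q$. Then $$n(k,7)\leq 2kq^2-q.$$ In particular, if $q$ is odd, then $$n(q-1,7)\leq 2q^3-2q^2-q=2(q-1)^3+4(q-1)^2+(q-1)-1.$$
   Context: Graphs are finite and simple. The girth of a graph is the length of its shortest cycle. A $(k,g)$-graph is a $k$-regular graph with girth (exactly) $g$. For $k\ge 2$ and $g\ge 3$, $n(k,g)$ denotes the minimum number of vertices of a $(k,g)$-graph (such graphs exist for all $k\geq 2$, $g\geq 3$ by a theorem of Erdős and Sachs). -}

module Defs where

open import Data.Bool using (Bool; true; false)
open import Data.Fin using (Fin; zero; suc; inject₁; fromℕ)
open import Data.Fin.Subset using (Subset; ∣_∣)
open import Data.Nat using (ℕ; suc; _≤_; _^_)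
open import Data.Nat.Primality using (Prime)
open import Data.Product using (_×_; ∃-syntax)
open import Data.Vec using (tabulate)
open import Function.Definitions using (Injective)
open import Relation.Binary.PropositionalEquality using (_≡_)

IsLeast : (ℕ → Set) → ℕ → Set
IsLeast P n = P n × (∀ m → P m → n ≤ m)

IsPrimePower : ℕ → Set
IsPrimePower q = ∃[ p ] ∃[ a ] (Prime p × 1 ≤ a × q ≡ p ^ a)

record Graph (n : ℕ) : Set where
  field
    adj       : Fin n → Fin n → Bool
    symmetric : ∀ u v → adj u v ≡ adj v u
    loopless  : ∀ v → adj v v ≡ false

  Adj : Fin n → Fin n → Set
  Adj u v = adj u v ≡ true

  neighbours : Fin n → Subset n
  neighbours v = tabulate (adj v)

  degree : Fin n → ℕ
  degree v = ∣ neighbours v ∣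

open Graph public using (Adj; degree)

IsRegular : ∀ {n} → Graph n → ℕ → Set
IsRegular G k = ∀ v → degree G v ≡ k

-- Distinct vertices v₀, …, vₘ with m ≥ 2, consecutive ones adjacent and vₘ
-- adjacent to v₀. The index is the length, that is, the number m + 1 of edges.
data Cycle {n} (G : Graph n) : ℕ → Set where
  cycle : ∀ {m} (v : Fin (suc m) → Fin n) →
          2 ≤ m →
          Injective _≡_ _≡_ v →
          (∀ (i : Fin m) → Adj G (v (inject₁ i)) (v (suc i))) →
          Adj G (v (fromℕ m)) (v zero) →
          Cycle G (suc m)

HasGirth : ∀ {n} → Graph n → ℕ → Set
HasGirth G = IsLeast (Cycle G)

record Is[_,_]-graph (k g : ℕ) {n} (G : Graph n) : Set where
  field
    regular : IsRegular G k
    girth   : HasGirth G g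

-- IsMinOrder k g n says that n(k,g) is defined and equal to n. A relation is
-- used because n(k,g) as a function presupposes the Erdős–Sachs theorem.
IsMinOrder : ℕ → ℕ → ℕ → Set
IsMinOrder k g = IsLeast λ n → ∃[ G ] Is[ k , g ]-graph {n} G

{-# OPTIONS --safe #-}
module Submission where

-- Let A and B be k-subsets of a field with q elements, 0 ∈ A. The points (x, y, z) with
-- x ∈ A and the lines [s, u, w] with s ∈ B, incident when y + u = x s and z + w = x u,
-- form a k-regular graph of girth at least eight on 2kq² vertices. The neighbourhoods
-- of the q points (0, 0, z) are the sets {[s, 0, w] : s ∈ B}, and these are so far from
-- each other that after deleting the q points and adding a perfect matching inside
-- each neighbourhood (k is even) the girth is still at least seven. If 0, 1, −1 ∈ B, with
-- 0 matched to 1, then there is a cycle of length seven. The least order of a (k, 7)-graph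
-- exists because it can be decided whether there is one with n vertices.
--
-- For the field with q = pᵃ elements, let ℤ/p[X]/(X^q − X) act on a module. All its
-- elements satisfy f^q = f, so f^(q−1) is idempotent, and passing from a vector w to
-- f^(q−1) w whenever f w ≠ 0, for each of the finitely many f in turn, leads to a vector
-- v ≠ 0 for which each f is zero or invertible modulo the annihilator of v. If one starts
-- with a vector not killed by the product of X^(pᵈ) − X for 0 < d < a, then X has a
-- distinct conjugates in the field obtained, so that the pᵃ polynomials of degree < a in X
-- are distinct; being roots of Y^q − Y they are all of the field.

open import Defs
open import Algebra.Bundles using (AbelianGroup; CommutativeRing; RawRing)
open import Data.Bool using (Bool; false; true)
import Data.Bool.Properties as Bool
open import Data.Empty using (⊥)
open import Data.Fin as Fin
  using (Fin; combine; finToFun; fromℕ; fromℕ<; funToFin; inject₁; inject≤; remQuot; suc; toℕ; zero)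
open import Data.Fin.Patterns using (0F; 1F; 2F; 3F; 4F; 5F; 6F)
open import Data.Fin.Permutation.Components using (transpose; transpose-inverse)
import Data.Fin.Properties as Fin
open import Data.Fin.Subset using (Subset; ∣_∣)
open import Data.Maybe using (Maybe; map)
open import Data.Nat as ℕ using (ℕ; _<_; _≤_; _∸_; pred; s<s; s≤s; suc; z≤n; zero; NonZero)
open import Data.Nat.Combinatorics using (nCn≡1)
open import Data.Nat.Coprimality using (coprime-Bézout; coprime-divisor; prime⇒coprime)
open import Data.Nat.DivMod
  using (_/_; _%_; _mod_; %-distribˡ-*; %-distribˡ-+; [m+n]%n≡m%n; m%n<n; m*n%n≡0; m<n⇒m%n≡m;
         m≡m%n+[m/n]*n)
open import Data.Nat.Divisibility using (_∣_; divides; m%n≡0⇒n∣m; m∣m*n)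
open import Data.Nat.GCD using (module Bézout)
open import Data.Nat.Induction using (<-rec)
open import Data.Nat.Primality using (Prime; prime⇒nonTrivial; prime⇒nonZero)
import Data.Nat.Properties as ℕ
open import Data.Nat.Solver using (module +-*-Solver)
open import Data.Product using (_×_; _,_; ∃-syntax; proj₁; proj₂; uncurry)
open import Data.Product.Function.NonDependent.Propositional using (_×-↔_)
open import Data.Product.Properties using (,-injectiveˡ)
open import Data.Sum using (_⊎_; inj₁; inj₂)
open import Data.Sum.Function.Propositional using (_⊎-↔_)
open import Data.Sum.Properties using (inj₁-injective)
open import Data.Vec using (Vec; _∷_; []; lookup; tabulate)
open import Data.Vec.Properties using (lookup∘tabulate; tabulate-cong)
open import Function using (_∘_; _↔_; Inverse; mk⇔)
open import Function.Construct.Composition using (_↔-∘_)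
open import Function.Construct.Identity using (↔-id)
open import Function.Definitions using (Injective)
open import Level using (0ℓ)
open import Relation.Binary.Consequences using (dec⇒weaklyDec)
open import Relation.Binary.Definitions using (tri<; tri>; tri≈) renaming (Decidable to Decidable₂)
open import Relation.Binary.PropositionalEquality as ≡ using (_≡_; _≢_; _≗_; cong; cong₂; subst)
open import Relation.Nullary using (¬_; Dec; contradiction; does; no; yes; ¬?)
open import Relation.Nullary.Decidable
  using (_×-dec_; _→-dec_; dec-false; dec-true; does-⇔; from-yes; map′)
open import Relation.Unary using (Decidable)

-- Coefficients are differences (m , n) = m − n of naturals with m = 0 or n = 0: with
-- them the solver recognises that x − x vanishes in an abstract ring, where equality
-- is opaque.
module DifferenceSolver (R : CommutativeRing 0ℓ 0ℓ) where
  open CommutativeRing R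
  open import Algebra.Properties.Monoid.Mult +-monoid using (×-homo-+) renaming (_×_ to _·_)
  open import Algebra.Properties.Semiring.Mult semiring using (×1-homo-*)
  open import Algebra.Properties.AbelianGroup +-abelianGroup
    using (⁻¹-∙-comm; ⁻¹-anti-homo‿-)
  open import Algebra.Properties.Group +-group using (x∙y⁻¹≈ε⇒x≈y) renaming (ε⁻¹≈ε to -0≈0)
  open import Algebra.Properties.Ring ring using (x[y-z]≈xy-xz; [y-z]x≈yx-zx)
  open import Algebra.Properties.CommutativeSemigroup +-commutativeSemigroup using (interchange)
  open import Algebra.Solver.Ring.AlmostCommutativeRing
    using (fromCommutativeRing; _-Raw-AlmostCommutative⟶_)
  open import Relation.Binary.Reasoning.Setoid setoid

  cancelled : ℕ → ℕ → ℕ × ℕ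
  cancelled (suc a) (suc b) = cancelled a b
  cancelled a       b       = a , b

  coefficients : RawRing 0ℓ 0ℓ
  coefficients = record
    { Carrier = ℕ × ℕ
    ; _≈_     = λ (a , b) (c , d) → a ℕ.+ d ≡ c ℕ.+ b
    ; _+_     = λ (a , b) (c , d) → cancelled (a ℕ.+ c) (b ℕ.+ d)
    ; _*_     = λ (a , b) (c , d) → cancelled (a ℕ.* c ℕ.+ b ℕ.* d) (a ℕ.* d ℕ.+ b ℕ.* c)
    ; -_      = λ (a , b) → b , a
    ; 0#      = 0 , 0
    ; 1#      = 1 , 0
    }

  ⟦_⟧ : ℕ × ℕ → Carrier
  ⟦ a , b ⟧ = a · 1# - b · 1#

  -‿interchange : ∀ x y z w → (x + y) - (z + w) ≈ (x - z) + (y - w)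
  -‿interchange x y z w = trans (+-congˡ (sym (⁻¹-∙-comm z w))) (interchange x y (- z) (- w))

  ⟦cancelled⟧ : ∀ a b → ⟦ cancelled a b ⟧ ≈ ⟦ a , b ⟧
  ⟦cancelled⟧ zero    b       = refl
  ⟦cancelled⟧ (suc a) zero    = refl
  ⟦cancelled⟧ (suc a) (suc b) = begin
    ⟦ cancelled a b ⟧                    ≈⟨ ⟦cancelled⟧ a b ⟩
    a · 1# - b · 1#                      ≈⟨ +-identityˡ _ ⟨
    0# + (a · 1# - b · 1#)               ≈⟨ +-congʳ (-‿inverseʳ 1#) ⟨
    (1# - 1#) + (a · 1# - b · 1#)        ≈⟨ -‿interchange _ _ _ _ ⟨
    (1# + a · 1#) - (1# + b · 1#)        ∎

  ⟦⟧-* : ∀ a b c d → ⟦ a ℕ.* c ℕ.+ b ℕ.* d , a ℕ.* d ℕ.+ b ℕ.* c ⟧ ≈ ⟦ a , b ⟧ * ⟦ c , d ⟧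
  ⟦⟧-* a b c d = begin
    (a ℕ.* c ℕ.+ b ℕ.* d) · 1# - (a ℕ.* d ℕ.+ b ℕ.* c) · 1#
      ≈⟨ +-cong (products a c b d) (-‿cong (products a d b c)) ⟩
    (A * C + B * D) - (A * D + B * C)
      ≈⟨ -‿interchange _ _ _ _ ⟩
    (A * C - A * D) + (B * D - B * C)
      ≈⟨ +-congˡ (sym (⁻¹-anti-homo‿- (B * C) (B * D))) ⟩
    (A * C - A * D) - (B * C - B * D)
      ≈⟨ +-cong (x[y-z]≈xy-xz A C D) (-‿cong (x[y-z]≈xy-xz B C D)) ⟨
    A * (C - D) - B * (C - D)
      ≈⟨ [y-z]x≈yx-zx (C - D) A B ⟨
    (A - B) * (C - D) ∎
    where
    A = a · 1#; B = b · 1#; C = c · 1#; D = d · 1#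
    products : ∀ a b c d → (a ℕ.* b ℕ.+ c ℕ.* d) · 1# ≈ (a · 1#) * (b · 1#) + (c · 1#) * (d · 1#)
    products a b c d = trans (×-homo-+ 1# (a ℕ.* b) (c ℕ.* d))
                             (+-cong (×1-homo-* a b) (×1-homo-* c d))

  -- Agrees with ⟦_⟧, but makes the numerals 0 and 1 of the solver denote 0# and 1#
  -- on the nose.
  value : ℕ × ℕ → Carrier
  value (0 , 0) = 0#
  value (1 , 0) = 1#
  value (a , b) = ⟦ a , b ⟧

  value≈ : ∀ x → value x ≈ ⟦ x ⟧
  value≈ (0             , 0)     = sym (-‿inverseʳ 0#)
  value≈ (1             , 0)     = sym (trans (+-cong (+-identityʳ 1#) -0≈0) (+-identityʳ 1#))
  value≈ (suc (suc a)   , 0)     = refl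
  value≈ (0             , suc b) = refl
  value≈ (1             , suc b) = refl
  value≈ (suc (suc a)   , suc b) = refl

  evaluation : coefficients -Raw-AlmostCommutative⟶ fromCommutativeRing R
  evaluation = record
    { ⟦_⟧    = value
    ; +-homo = λ (a , b) (c , d) → via (cancelled (a ℕ.+ c) (b ℕ.+ d))
        (trans (⟦cancelled⟧ (a ℕ.+ c) (b ℕ.+ d))
          (trans (+-cong (×-homo-+ 1# a c) (-‿cong (×-homo-+ 1# b d))) (-‿interchange _ _ _ _)))
        (+-cong (value≈ (a , b)) (value≈ (c , d)))
    ; *-homo = λ (a , b) (c , d) →
        via (cancelled (a ℕ.* c ℕ.+ b ℕ.* d) (a ℕ.* d ℕ.+ b ℕ.* c))
          (trans (⟦cancelled⟧ (a ℕ.* c ℕ.+ b ℕ.* d) (a ℕ.* d ℕ.+ b ℕ.* c)) (⟦⟧-* a b c d))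
          (*-cong (value≈ (a , b)) (value≈ (c , d)))
    ; -‿homo = λ (a , b) →
        via (b , a) (sym (⁻¹-anti-homo‿- (a · 1#) (b · 1#))) (-‿cong (value≈ (a , b)))
    ; 0-homo = refl
    ; 1-homo = refl
    }
    where
    via : ∀ x {y z} → ⟦ x ⟧ ≈ y → z ≈ y → value x ≈ z
    via x x≈y z≈y = trans (value≈ x) (trans x≈y (sym z≈y))

  equal? : ∀ x y → Maybe (value x ≈ value y)
  equal? (a , b) (c , d) = map sound (dec⇒weaklyDec ℕ._≟_ (a ℕ.+ d) (c ℕ.+ b))
    where
    sound : a ℕ.+ d ≡ c ℕ.+ b → value (a , b) ≈ value (c , d)
    sound eq = trans (value≈ (a , b)) (trans (x∙y⁻¹≈ε⇒x≈y _ _ (begin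
      (a · 1# - b · 1#) - (c · 1# - d · 1#)
        ≈⟨ +-congˡ (⁻¹-anti-homo‿- _ _) ⟩
      (a · 1# - b · 1#) + (d · 1# - c · 1#)
        ≈⟨ -‿interchange _ _ _ _ ⟨
      (a · 1# + d · 1#) - (b · 1# + c · 1#)
        ≈⟨ +-cong (×-homo-+ 1# a d) (-‿cong (trans (×-homo-+ 1# c b) (+-comm _ _))) ⟨
      (a ℕ.+ d) · 1# - (c ℕ.+ b) · 1#
        ≡⟨ cong (λ n → n · 1# - (c ℕ.+ b) · 1#) eq ⟩
      (c ℕ.+ b) · 1# - (c ℕ.+ b) · 1#
        ≈⟨ -‿inverseʳ _ ⟩
      0# ∎)) (sym (value≈ (c , d))))

  open import Algebra.Solver.Ring coefficients (fromCommutativeRing R) evaluation equal? public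
    using (Polynomial; solve; _:=_; _:+_; _:*_; _:-_; :-_; con)
  :0 :1 : ∀ {n} → Polynomial n
  :0 = con (0 , 0)
  :1 = con (1 , 0)

-- Prime characteristic

module _ where
  open import Data.Nat.Combinatorics using (_C_; nCk+nC[k+1]≡[n+1]C[k+1])

  -- Pascal's rule splits the left side; the induction hypothesis rewrites the second summand, and
  -- `rest` uses it once more, one index lower, on what remains.
  absorption : ∀ n k → suc k ℕ.* (suc n C suc k) ≡ suc n ℕ.* (n C k)
  absorption zero    zero    = ≡.refl
  absorption zero    (suc k) = ℕ.*-zeroʳ k
  absorption (suc n) k = begin
    suc k ℕ.* (suc (suc n) C suc k)
      ≡⟨ cong (suc k ℕ.*_) (nCk+nC[k+1]≡[n+1]C[k+1] (suc n) k) ⟨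
    suc k ℕ.* (suc n C k ℕ.+ suc n C suc k)
      ≡⟨ ℕ.*-distribˡ-+ (suc k) (suc n C k) (suc n C suc k) ⟩
    suc n C k ℕ.+ k ℕ.* (suc n C k) ℕ.+ suc k ℕ.* (suc n C suc k)
      ≡⟨ ℕ.+-assoc (suc n C k) _ _ ⟩
    suc n C k ℕ.+ (k ℕ.* (suc n C k) ℕ.+ suc k ℕ.* (suc n C suc k))
      ≡⟨ cong (λ m → suc n C k ℕ.+ (k ℕ.* (suc n C k) ℕ.+ m)) (absorption n k) ⟩
    suc n C k ℕ.+ (k ℕ.* (suc n C k) ℕ.+ suc n ℕ.* (n C k))
      ≡⟨ cong (suc n C k ℕ.+_) (rest k) ⟩
    suc (suc n) ℕ.* (suc n C k) ∎
    where
    open ≡.≡-Reasoning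
    rest : ∀ k → k ℕ.* (suc n C k) ℕ.+ suc n ℕ.* (n C k) ≡ suc n ℕ.* (suc n C k)
    rest zero    = ≡.refl
    rest (suc k) = begin
      suc k ℕ.* (suc n C suc k) ℕ.+ suc n ℕ.* (n C suc k)
        ≡⟨ cong (ℕ._+ suc n ℕ.* (n C suc k)) (absorption n k) ⟩
      suc n ℕ.* (n C k) ℕ.+ suc n ℕ.* (n C suc k)
        ≡⟨ ℕ.*-distribˡ-+ (suc n) (n C k) (n C suc k) ⟨
      suc n ℕ.* (n C k ℕ.+ n C suc k)
        ≡⟨ cong (suc n ℕ.*_) (nCk+nC[k+1]≡[n+1]C[k+1] n k) ⟩
      suc n ℕ.* (suc n C suc k) ∎

  -- By `absorption`, p divides suc k times the binomial coefficient, and it is coprime to suc k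
  -- because 0 < suc k < p.
  prime∣binomial : ∀ {p} → Prime p → ∀ k → suc k < p → p ∣ (p C suc k)
  prime∣binomial {suc n} p-prime k k<p =
    coprime-divisor (prime⇒coprime p-prime k<p)
      (subst (suc n ∣_) (≡.sym (absorption n k)) (m∣m*n (n C k)))

module Characteristic (R : CommutativeRing 0ℓ 0ℓ) {p} (p-prime : Prime p) where
  open CommutativeRing R hiding (zero)
  open import Algebra.Properties.Monoid.Mult +-monoid
    using (×-congˡ; ×-congʳ; ×-assocˡ; ×-homo-1) renaming (_×_ to _·_)
  open import Algebra.Properties.Semiring.Mult semiring using (×-assoc-*)
  open import Algebra.Properties.Semiring.Exp semiring using (_^_; ^-assocʳ; ^-congˡ)
  open import Algebra.Properties.CommutativeSemiring.Binomial commutativeSemiring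
    using (binomialTerm; theorem)
  open import Algebra.Properties.Monoid.Sum +-monoid
    using (sum; sum-init-last; sum-cong-≋; sum-replicate-zero)
  open import Algebra.Properties.Group +-group using (inverseˡ-unique)
  open import Algebra.Properties.Ring ring using (x+x≈x⇒x≈0)
  open import Relation.Binary.Reasoning.Setoid setoid

  module Frobenius (p·1≈0 : p · 1# ≈ 0#) where

    p·x≈0 : ∀ x → p · x ≈ 0#
    p·x≈0 x = begin
      p · x          ≈⟨ ×-congʳ p (*-identityˡ x) ⟨
      p · (1# * x)   ≈⟨ ×-assoc-* p 1# x ⟨
      (p · 1#) * x   ≈⟨ *-congʳ p·1≈0 ⟩
      0# * x         ≈⟨ zeroˡ x ⟩
      0#             ∎

    p∣n⇒n·x≈0 : ∀ {n} → p ∣ n → ∀ x → n · x ≈ 0#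
    p∣n⇒n·x≈0 (divides m ≡.refl) x = begin
      (m ℕ.* p) · x ≈⟨ ×-congˡ {x} (ℕ.*-comm m p) ⟩
      (p ℕ.* m) · x ≈⟨ ×-assocˡ x p m ⟨
      p · (m · x)   ≈⟨ p·x≈0 _ ⟩
      0#            ∎

    -- Only the two end terms of the binomial expansion survive, since p divides every coefficient
    -- between them.
    [x+y]^p : ∀ x y → (x + y) ^ p ≈ x ^ p + y ^ p
    [x+y]^p x y = helper p ≡.refl
      where
      -- The exponent p becomes a variable `n` that can be matched as a successor; the binomial sum
      -- then splits into first, middle and last terms.
      helper : ∀ n → n ≡ p → (x + y) ^ n ≈ x ^ n + y ^ n
      helper zero    ≡.refl with () ← ℕ.≢-nonZero⁻¹ 0 {{prime⇒nonZero p-prime}} ≡.refl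
      helper (suc n) ≡.refl = begin
        (x + y) ^ suc n
          ≈⟨ theorem (suc n) x y ⟩
        t zero + sum (t ∘ suc)
          ≈⟨ +-cong (trans (×-homo-1 _) (*-identityˡ _)) (sum-init-last (t ∘ suc)) ⟩
        y ^ suc n + (sum (t ∘ suc ∘ inject₁) + t (suc (fromℕ n)))
          ≈⟨ +-congˡ (+-cong middle last) ⟩
        y ^ suc n + (0# + x ^ suc n)
          ≈⟨ +-congˡ (+-identityˡ _) ⟩
        y ^ suc n + x ^ suc n
          ≈⟨ +-comm _ _ ⟩
        x ^ suc n + y ^ suc n ∎
        where
        t : Fin (suc (suc n)) → Carrier
        t = binomialTerm x y (suc n)
        middle : sum (t ∘ suc ∘ inject₁) ≈ 0#
        middle = trans (sum-cong-≋ vanishes) (sum-replicate-zero n)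
          where
          vanishes : ∀ i → t (suc (inject₁ i)) ≈ 0#
          vanishes i = p∣n⇒n·x≈0 (prime∣binomial p-prime _
            (s<s (subst (_< n) (≡.sym (Fin.toℕ-inject₁ i)) (Fin.toℕ<n i)))) _
        last : t (suc (fromℕ n)) ≈ x ^ suc n
        last rewrite Fin.toℕ-fromℕ n | nCn≡1 (suc n) | ℕ.n∸n≡0 n =
          trans (×-homo-1 _) (*-identityʳ _)

    [x+y]^pᵃ : ∀ a x y → (x + y) ^ (p ℕ.^ a) ≈ x ^ (p ℕ.^ a) + y ^ (p ℕ.^ a)
    [x+y]^pᵃ zero    x y = trans (*-identityʳ _) (sym (+-cong (*-identityʳ x) (*-identityʳ y)))
    [x+y]^pᵃ (suc a) x y = begin
      (x + y) ^ (p ℕ.* p ℕ.^ a)                      ≈⟨ ^-assocʳ (x + y) p (p ℕ.^ a) ⟨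
      ((x + y) ^ p) ^ (p ℕ.^ a)                      ≈⟨ ^-congˡ (p ℕ.^ a) ([x+y]^p x y) ⟩
      (x ^ p + y ^ p) ^ (p ℕ.^ a)                    ≈⟨ [x+y]^pᵃ a (x ^ p) (y ^ p) ⟩
      (x ^ p) ^ (p ℕ.^ a) + (y ^ p) ^ (p ℕ.^ a)      ≈⟨ +-cong (^-assocʳ x p _) (^-assocʳ y p _) ⟩
      x ^ (p ℕ.* p ℕ.^ a) + y ^ (p ℕ.* p ℕ.^ a)      ∎

    -- Additivity makes the power of zero equal to its own double.
    0^pᵃ : ∀ a → 0# ^ (p ℕ.^ a) ≈ 0#
    0^pᵃ a = x+x≈x⇒x≈0 _ (begin
      0# ^ (p ℕ.^ a) + 0# ^ (p ℕ.^ a) ≈⟨ [x+y]^pᵃ a 0# 0# ⟨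
      (0# + 0#) ^ (p ℕ.^ a)           ≈⟨ ^-congˡ (p ℕ.^ a) (+-identityˡ 0#) ⟩
      0# ^ (p ℕ.^ a)                  ∎)

    -- Derived from additivity, so that p = 2 and odd p are treated alike.
    [-x]^pᵃ : ∀ a x → (- x) ^ (p ℕ.^ a) ≈ - (x ^ (p ℕ.^ a))
    [-x]^pᵃ a x = inverseˡ-unique _ _ (begin
      (- x) ^ (p ℕ.^ a) + x ^ (p ℕ.^ a) ≈⟨ [x+y]^pᵃ a (- x) x ⟨
      (- x + x) ^ (p ℕ.^ a)             ≈⟨ ^-congˡ (p ℕ.^ a) (-‿inverseˡ x) ⟩
      0# ^ (p ℕ.^ a)                    ≈⟨ 0^pᵃ a ⟩
      0#                                ∎)

    1^n : ∀ n → 1# ^ n ≈ 1#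
    1^n zero    = refl
    1^n (suc n) = trans (*-identityˡ _) (1^n n)

    [n·1]^pᵃ : ∀ a n → (n · 1#) ^ (p ℕ.^ a) ≈ n · 1#
    [n·1]^pᵃ a zero    = 0^pᵃ a
    [n·1]^pᵃ a (suc n) = trans ([x+y]^pᵃ a _ _) (+-cong (1^n (p ℕ.^ a)) ([n·1]^pᵃ a n))

-- Polynomials, their roots, and counting the elements of a field

module PolynomialFunctions (R : CommutativeRing 0ℓ 0ℓ) where
  open CommutativeRing R hiding (zero)
  open import Algebra.Properties.Monoid.Mult +-monoid using () renaming (_×_ to _·_)
  open import Algebra.Properties.Semiring.Exp semiring using (_^_; ^-assocʳ; ^-congˡ; ^-congʳ)
  open import Algebra.Properties.Group +-group using (x∙y⁻¹≈ε⇒x≈y)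
  open import Relation.Binary.Reasoning.Setoid setoid
  open DifferenceSolver R

  eval : ∀ {n} → (Fin n → Carrier) → Carrier → Carrier
  eval {zero}  c t = 0#
  eval {suc n} c t = c zero + t * eval (c ∘ suc) t

  eval-- : ∀ {n} (c d : Fin n → Carrier) t → eval (λ i → c i - d i) t ≈ eval c t - eval d t
  eval-- {zero}  c d t = sym (-‿inverseʳ 0#)
  eval-- {suc n} c d t = trans (+-congˡ (*-congˡ (eval-- (c ∘ suc) (d ∘ suc) t)))
    (solve 5 (λ c d t x y → (c :- d) :+ t :* (x :- y) := (c :+ t :* x) :- (d :+ t :* y)) refl
       (c zero) (d zero) t (eval (c ∘ suc) t) (eval (d ∘ suc) t))

  monomial : ∀ n → Fin (suc n) → Carrier
  monomial zero    i       = 1#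
  monomial (suc n) zero    = 0#
  monomial (suc n) (suc i) = monomial n i

  eval-monomial : ∀ n t → eval (monomial n) t ≈ t ^ n
  eval-monomial zero    t = trans (+-congˡ (zeroʳ t)) (+-identityʳ 1#)
  eval-monomial (suc n) t = trans (+-identityˡ _) (*-congˡ (eval-monomial n t))

  monomial-leading : ∀ n → monomial n (fromℕ n) ≡ 1#
  monomial-leading zero    = ≡.refl
  monomial-leading (suc n) = monomial-leading n

  -- Synthetic division: the coefficients of the quotient of `c` by X - r, the remainder being
  -- `eval c r`.
  divide : ∀ {n} → Carrier → (Fin (suc n) → Carrier) → Fin n → Carrier
  divide {suc n} r c zero    = eval (c ∘ suc) r
  divide {suc n} r c (suc i) = divide r (c ∘ suc) i

  eval-divide : ∀ {n} r (c : Fin (suc n) → Carrier) t →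
                eval c t ≈ eval c r + (t - r) * eval (divide r c) t
  eval-divide {zero}  r c t =
    solve 3 (λ c r t → c :+ t :* :0 := c :+ r :* :0 :+ (t :- r) :* :0) refl (c zero) r t
  eval-divide {suc n} r c t = begin
    c zero + t * eval c′ t
      ≈⟨ +-congˡ (*-congˡ (eval-divide r c′ t)) ⟩
    c zero + t * (eval c′ r + (t - r) * eval (divide r c′) t)
      ≈⟨ solve 5 (λ c t r x y → c :+ t :* (x :+ (t :- r) :* y)
                             := c :+ r :* x :+ (t :- r) :* (x :+ t :* y))
           refl (c zero) t r (eval c′ r) (eval (divide r c′) t) ⟩
    c zero + r * eval c′ r + (t - r) * (eval c′ r + t * eval (divide r c′) t) ∎
    where c′ = c ∘ suc

  -- The first coefficient of the quotient is the value at `r` of the tail of `c`. Its vanishing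
  -- makes `r` a root of the tail, which forces `c zero` to vanish and allows recursion on the tail.
  divide-zero : ∀ {n} r (c : Fin (suc n) → Carrier) →
                eval c r ≈ 0# → (∀ i → divide r c i ≈ 0#) → ∀ i → c i ≈ 0#
  divide-zero r c root vanish = λ where
      zero            → trans (sym (trans (+-congˡ (trans (*-congˡ (tail-root vanish)) (zeroʳ r)))
                                          (+-identityʳ _))) root
      (suc i)         → tail-zero vanish i
    where
    tail-root : ∀ {n} {c : Fin (suc n) → Carrier} → (∀ i → divide r c i ≈ 0#) → eval (c ∘ suc) r ≈ 0#
    tail-root {zero}  vanish = refl
    tail-root {suc n} vanish = vanish zero
    tail-zero : ∀ {n} {c : Fin (suc n) → Carrier} → (∀ i → divide r c i ≈ 0#) → ∀ i → c (suc i) ≈ 0#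
    tail-zero {suc n} {c} vanish = divide-zero r (c ∘ suc) (vanish zero) (vanish ∘ suc)

  module Roots (cancel : ∀ {x y} → x * y ≈ 0# → ¬ x ≈ 0# → y ≈ 0#) where

    -- A polynomial of degree below n with n distinct roots is zero: after division by X minus the
    -- first root, cancellation makes the other roots be roots of the quotient.
    vanishing : ∀ {n} (c r : Fin n → Carrier) → (∀ {i j} → r i ≈ r j → i ≡ j) →
                (∀ i → eval c (r i) ≈ 0#) → ∀ i → c i ≈ 0#
    vanishing {suc n} c r inj root =
      divide-zero (r zero) c (root zero)
        (vanishing (divide (r zero) c) (r ∘ suc) (Fin.suc-injective ∘ inj) λ i →
          cancel
            (trans (sym (+-identityˡ _))
              (trans (+-congʳ (sym (root zero)))
                (trans (sym (eval-divide (r zero) c (r (suc i)))) (root (suc i)))))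
            (λ eq → contradiction (inj (x∙y⁻¹≈ε⇒x≈y _ _ eq)) λ ()))

  -- For a domain of characteristic p in which every element is a root of Y^q - Y, with an element
  -- `x` fixed by no smaller power of Frobenius, this lists exactly q elements. The degree over the
  -- prime field is `suc a`.
  module Enumeration
    (_≟_ : Decidable₂ _≈_)
    (cancel : ∀ {x y} → x * y ≈ 0# → ¬ x ≈ 0# → y ≈ 0#)
    (1≉0 : ¬ 1# ≈ 0#)
    {p} (p-prime : Prime p) (p·1≈0 : p · 1# ≈ 0#)
    {a} (x^q≈x : ∀ x → x ^ (p ℕ.^ suc a) ≈ x)
    (x : Carrier) (x-generates : ∀ d → d < a → ¬ x ^ (p ℕ.^ suc d) ≈ x)
    where

    open Roots cancel
    open Characteristic R p-prime
    open Frobenius p·1≈0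
    open import Algebra.Properties.CommutativeSemiring.Exp commutativeSemiring using (^-distrib-*)
    open import Algebra.Properties.Semiring.Mult semiring using (×1-homo-*)
    open import Algebra.Properties.Group +-group using (x≈y⇒x∙y⁻¹≈ε; ∙-cancelˡ)

    multiple : ∀ m n → n · 1# ≈ 0# → (m ℕ.* n) · 1# ≈ 0#
    multiple m n eq = trans (×1-homo-* m n) (trans (*-congˡ eq) (zeroʳ _))

    -- Otherwise a Bézout relation between p and suc n, both of which vanish in the ring, would make
    -- 1 vanish.
    n·1≉0 : ∀ n → suc n < p → ¬ suc n · 1# ≈ 0#
    n·1≉0 n n<p n·1≈0 with coprime-Bézout (prime⇒coprime p-prime n<p)
    ... | Bézout.+- u v eq = 1≉0 (begin
      1#                                 ≈⟨ +-identityʳ 1# ⟨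
      1# + 0#                            ≈⟨ +-congˡ (multiple v (suc n) n·1≈0) ⟨
      1# + (v ℕ.* suc n) · 1#            ≡⟨ cong (_· 1#) eq ⟩
      (u ℕ.* p) · 1#                     ≈⟨ multiple u p p·1≈0 ⟩
      0#                                 ∎)
    ... | Bézout.-+ u v eq = 1≉0 (begin
      1#                                 ≈⟨ +-identityʳ 1# ⟨
      1# + 0#                            ≈⟨ +-congˡ (multiple u p p·1≈0) ⟨
      1# + (u ℕ.* p) · 1#                ≡⟨ cong (_· 1#) eq ⟩
      (v ℕ.* suc n) · 1#                 ≈⟨ multiple v (suc n) n·1≈0 ⟩
      0#                                 ∎)

    ·1-injective : ∀ {m n} → m < p → n < p → m · 1# ≈ n · 1# → m ≡ n
    ·1-injective {zero}  {zero}  _ _ eq = ≡.refl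
    ·1-injective {zero}  {suc n} _ n<p eq = contradiction (sym eq) (n·1≉0 n n<p)
    ·1-injective {suc m} {zero}  m<p _ eq = contradiction eq (n·1≉0 m m<p)
    ·1-injective {suc m} {suc n} m<p n<p eq =
      cong suc (·1-injective (ℕ.<-trans (ℕ.n<1+n m) m<p) (ℕ.<-trans (ℕ.n<1+n n) n<p)
                             (∙-cancelˡ 1# _ _ eq))

    -- Raising a coincidence to the power p^(a + 1 - j) turns the right side into x^q = x, and the
    -- left side into the image of x under fewer than a + 1 Frobenius steps.
    conjugates-distinct : ∀ {i j} → i < j → j < suc a → ¬ x ^ (p ℕ.^ i) ≈ x ^ (p ℕ.^ j)
    conjugates-distinct {i} {j} i<j j≤a eq = x-generates (i ℕ.+ (a ∸ j)) bound (begin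
      x ^ (p ℕ.^ suc (i ℕ.+ (a ∸ j)))          ≡⟨ cong (λ m → x ^ (p ℕ.^ m)) (ℕ.+-suc i (a ∸ j)) ⟨
      x ^ (p ℕ.^ (i ℕ.+ suc (a ∸ j)))          ≡⟨ cong (x ^_) (ℕ.^-distribˡ-+-* p i (suc (a ∸ j))) ⟩
      x ^ (p ℕ.^ i ℕ.* p ℕ.^ suc (a ∸ j))      ≈⟨ ^-assocʳ x (p ℕ.^ i) _ ⟨
      (x ^ (p ℕ.^ i)) ^ (p ℕ.^ suc (a ∸ j))    ≈⟨ ^-congˡ (p ℕ.^ suc (a ∸ j)) eq ⟩
      (x ^ (p ℕ.^ j)) ^ (p ℕ.^ suc (a ∸ j))    ≈⟨ ^-assocʳ x (p ℕ.^ j) _ ⟩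
      x ^ (p ℕ.^ j ℕ.* p ℕ.^ suc (a ∸ j))      ≡⟨ cong (x ^_) (ℕ.^-distribˡ-+-* p j (suc (a ∸ j))) ⟨
      x ^ (p ℕ.^ (j ℕ.+ suc (a ∸ j)))          ≡⟨ cong (λ m → x ^ (p ℕ.^ m)) (ℕ.+-suc j (a ∸ j)) ⟩
      x ^ (p ℕ.^ suc (j ℕ.+ (a ∸ j)))          ≡⟨ cong (λ m → x ^ (p ℕ.^ suc m)) (ℕ.m+[n∸m]≡n (ℕ.s≤s⁻¹ j≤a)) ⟩
      x ^ (p ℕ.^ suc a)                        ≈⟨ x^q≈x x ⟩
      x                                        ∎)
      where
      bound : i ℕ.+ (a ∸ j) < a
      bound = subst (i ℕ.+ (a ∸ j) <_) (ℕ.m+[n∸m]≡n (ℕ.s≤s⁻¹ j≤a)) (ℕ.+-monoˡ-< (a ∸ j) i<j)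

    conjugates-injective : ∀ {i j : Fin (suc a)} → x ^ (p ℕ.^ toℕ i) ≈ x ^ (p ℕ.^ toℕ j) → i ≡ j
    conjugates-injective {i} {j} eq with ℕ.<-cmp (toℕ i) (toℕ j)
    ... | tri≈ _ i≡j _ = Fin.toℕ-injective i≡j
    ... | tri< i<j _ _ = contradiction eq (conjugates-distinct i<j (Fin.toℕ<n j))
    ... | tri> _ _ j<i = contradiction (sym eq) (conjugates-distinct j<i (Fin.toℕ<n i))

    eval-frobenius : ∀ {n} (c : Fin n → Carrier) m → (∀ i → c i ^ (p ℕ.^ m) ≈ c i) →
                     ∀ t → eval c (t ^ (p ℕ.^ m)) ≈ eval c t ^ (p ℕ.^ m)
    eval-frobenius {zero}  c m fixed t = sym (0^pᵃ m)
    eval-frobenius {suc n} c m fixed t = sym (begin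
      (c zero + t * eval (c ∘ suc) t) ^ (p ℕ.^ m)
        ≈⟨ [x+y]^pᵃ m _ _ ⟩
      c zero ^ (p ℕ.^ m) + (t * eval (c ∘ suc) t) ^ (p ℕ.^ m)
        ≈⟨ +-cong (fixed zero) (^-distrib-* _ _ (p ℕ.^ m)) ⟩
      c zero + t ^ (p ℕ.^ m) * eval (c ∘ suc) t ^ (p ℕ.^ m)
        ≈⟨ +-congˡ (*-congˡ (eval-frobenius (c ∘ suc) m (fixed ∘ suc) t)) ⟨
      c zero + t ^ (p ℕ.^ m) * eval (c ∘ suc) (t ^ (p ℕ.^ m)) ∎)

    -- The base-p digits of the index, read in the prime field; `element` thus runs through the
    -- polynomials of degree at most a in `x`.
    digits : Fin (p ℕ.^ suc a) → Fin (suc a) → Carrier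
    digits i j = toℕ (finToFun {p} {suc a} i j) · 1#

    element : Fin (p ℕ.^ suc a) → Carrier
    element i = eval (digits i) x

    finToFun-injective : ∀ {m n} {i j : Fin (m ℕ.^ n)} →
                         (∀ l → finToFun {m} {n} i l ≡ finToFun j l) → i ≡ j
    finToFun-injective {m} {n} {i} {j} eq =
      ≡.trans (≡.sym (Fin.funToFin-finToFin {n} {m} i))
        (≡.trans (funToFin-cong eq) (Fin.funToFin-finToFin {n} {m} j))
      where
      funToFin-cong : ∀ {n} {f g : Fin n → Fin m} → (∀ l → f l ≡ g l) → funToFin f ≡ funToFin g
      funToFin-cong {zero}  eq = ≡.refl
      funToFin-cong {suc n} eq = cong₂ Fin.combine (eq zero) (funToFin-cong (eq ∘ suc))

    -- The difference of two such polynomials has coefficients fixed by Frobenius, so together with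
    -- `x` all a + 1 conjugates are roots of it. That is too many for its degree.
    element-injective : ∀ {i j} → element i ≈ element j → i ≡ j
    element-injective {i} {j} eq = finToFun-injective λ l →
      Fin.toℕ-injective (·1-injective (Fin.toℕ<n _) (Fin.toℕ<n _) (x∙y⁻¹≈ε⇒x≈y _ _ (difference-zero l)))
      where
      difference : Fin (suc a) → Carrier
      difference l = digits i l - digits j l
      fixed : ∀ m l → difference l ^ (p ℕ.^ m) ≈ difference l
      fixed m l = trans ([x+y]^pᵃ m _ _)
        (+-cong ([n·1]^pᵃ m (toℕ (finToFun {p} i l)))
                (trans ([-x]^pᵃ m _) (-‿cong ([n·1]^pᵃ m (toℕ (finToFun {p} j l))))))
      difference-zero : ∀ l → difference l ≈ 0#
      difference-zero = vanishing difference (λ m → x ^ (p ℕ.^ toℕ m)) conjugates-injective λ m → begin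
        eval difference (x ^ (p ℕ.^ toℕ m)) ≈⟨ eval-frobenius difference (toℕ m) (fixed (toℕ m)) x ⟩
        eval difference x ^ (p ℕ.^ toℕ m)
          ≈⟨ ^-congˡ (p ℕ.^ toℕ m) (trans (eval-- (digits i) (digits j) x) (x≈y⇒x∙y⁻¹≈ε eq)) ⟩
        0# ^ (p ℕ.^ toℕ m)                  ≈⟨ 0^pᵃ (toℕ m) ⟩
        0#                                  ∎

    -- A missing element together with the q listed ones would give q + 1 roots of Y^q - Y, and its
    -- leading coefficient 1 would vanish.
    element-surjective : ∀ y → ∃[ i ] element i ≈ y
    element-surjective y with Fin.any? (λ i → element i ≟ y)
    ... | yes found = found
    ... | no  none  = contradiction absurd 1≉0
      where
      q = p ℕ.^ suc a
      r : Fin (suc q) → Carrier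
      r zero    = y
      r (suc i) = element i
      r-injective : ∀ {i j} → r i ≈ r j → i ≡ j
      r-injective {zero}  {zero}  eq = ≡.refl
      r-injective {zero}  {suc j} eq = contradiction (j , sym eq) none
      r-injective {suc i} {zero}  eq = contradiction (i , eq) none
      r-injective {suc i} {suc j} eq = cong suc (element-injective eq)

      -- Coefficients of Y^(m + 2) - Y. Since q is at least 2, the coefficient -1 and the leading 1
      -- occupy different places.
      polynomial : ∀ m → Fin (3 ℕ.+ m) → Carrier
      polynomial m zero          = 0#
      polynomial m (suc zero)    = - 1#
      polynomial m (suc (suc i)) = monomial m i

      eval-polynomial : ∀ m t → t ^ (2 ℕ.+ m) ≈ t → eval (polynomial m) t ≈ 0#
      eval-polynomial m t t^q≈t = begin
        0# + t * (- 1# + t * eval (monomial m) t)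
          ≈⟨ +-congˡ (*-congˡ (+-congˡ (*-congˡ (eval-monomial m t)))) ⟩
        0# + t * (- 1# + t * t ^ m)
          ≈⟨ solve 2 (λ t u → :0 :+ t :* ((:- :1) :+ t :* u) := t :* (t :* u) :- t) refl t (t ^ m) ⟩
        t * (t * t ^ m) - t
          ≈⟨ x≈y⇒x∙y⁻¹≈ε t^q≈t ⟩
        0# ∎

      1<q : 1 < q
      1<q = ℕ.<-≤-trans (ℕ.nonTrivial⇒n>1 p {{prime⇒nonTrivial p-prime}})
                        (ℕ.m≤m*n p (p ℕ.^ a) {{ℕ.m^n≢0 p a {{prime⇒nonZero p-prime}}}})

      helper : ∀ n → n ≡ q → 1 < n → 1# ≈ 0#
      helper (suc zero)    _   (s≤s ())
      helper (suc (suc m)) n≡q _ = begin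
        1#                              ≡⟨ monomial-leading m ⟨
        monomial m (fromℕ m)            ≈⟨ vanishing (polynomial m) (r ∘ Fin.cast (cong suc n≡q))
                                             (Fin.toℕ-injective ∘ cast-injective ∘ r-injective)
                                             (λ i → eval-polynomial m _
                                               (trans (^-congʳ _ n≡q) (x^q≈x _)))
                                             (suc (suc (fromℕ m))) ⟩
        0#                              ∎
        where
        cast-injective : ∀ {m n} .{eq : m ≡ n} {i j : Fin m} → Fin.cast eq i ≡ Fin.cast eq j → toℕ i ≡ toℕ j
        cast-injective {eq = eq} {i} {j} e =
          ≡.trans (≡.sym (Fin.toℕ-cast eq i)) (≡.trans (cong toℕ e) (Fin.toℕ-cast eq j))

      absurd : 1# ≈ 0#
      absurd = helper q ≡.refl 1<q

-- The field with pᵃ elements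

infixl 6 _⊕_
infixl 7 _⊗_
infix  8 ⊖_
infixr 8 _↑_

-- Integral polynomials as syntax, compared only through their action on a vector. Nothing has to be
-- normalised, and most ring laws are inherited from the group acted upon.
data Poly : Set where
  𝕏 𝟘 𝟙   : Poly
  _⊕_ _⊗_ : Poly → Poly → Poly
  ⊖_      : Poly → Poly

_↑_ : Poly → ℕ → Poly
f ↑ zero  = 𝟙
f ↑ suc n = f ⊗ f ↑ n

constant : ℕ → Poly
constant zero    = 𝟘
constant (suc n) = 𝟙 ⊕ constant n

horner : ∀ {n} → (Fin n → ℕ) → Poly
horner {zero}  c = 𝟘
horner {suc n} c = constant (c zero) ⊕ 𝕏 ⊗ horner (c ∘ suc)

record Endomorphism (V : AbelianGroup 0ℓ 0ℓ) : Set where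
  open AbelianGroup V
  field
    T      : Carrier → Carrier
    T-cong : ∀ {u v} → u ≈ v → T u ≈ T v
    T-∙    : ∀ u v → T (u ∙ v) ≈ T u ∙ T v

-- Polynomials in an endomorphism of an abelian group

module Action {V : AbelianGroup 0ℓ 0ℓ} (endomorphism : Endomorphism V) where
  open AbelianGroup V
  open Endomorphism endomorphism
  open import Algebra.Properties.Group group using (inverseˡ-unique; identityˡ-unique)
  open import Algebra.Properties.CommutativeSemigroup (AbelianGroup.commutativeSemigroup V) using (interchange)

  infixr 5 _▷_

  _▷_ : Poly → Carrier → Carrier
  𝕏       ▷ v = T v
  𝟘       ▷ v = ε
  𝟙       ▷ v = v
  (f ⊕ g) ▷ v = (f ▷ v) ∙ (g ▷ v)
  (f ⊗ g) ▷ v = f ▷ g ▷ v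
  (⊖ f)   ▷ v = (f ▷ v) ⁻¹

  ▷-cong : ∀ f {u v} → u ≈ v → f ▷ u ≈ f ▷ v
  ▷-cong 𝕏       u≈v = T-cong u≈v
  ▷-cong 𝟘       u≈v = refl
  ▷-cong 𝟙       u≈v = u≈v
  ▷-cong (f ⊕ g) u≈v = ∙-cong (▷-cong f u≈v) (▷-cong g u≈v)
  ▷-cong (f ⊗ g) u≈v = ▷-cong f (▷-cong g u≈v)
  ▷-cong (⊖ f)   u≈v = ⁻¹-cong (▷-cong f u≈v)

  module Additive (φ : Carrier → Carrier) (φ-cong : ∀ {u v} → u ≈ v → φ u ≈ φ v)
                  (φ-∙ : ∀ u v → φ (u ∙ v) ≈ φ u ∙ φ v) where
    φ-ε : φ ε ≈ ε
    φ-ε = identityˡ-unique (φ ε) (φ ε) (trans (sym (φ-∙ ε ε)) (φ-cong (identityˡ ε)))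

    φ-⁻¹ : ∀ v → φ (v ⁻¹) ≈ φ v ⁻¹
    φ-⁻¹ v = inverseˡ-unique _ _ (trans (sym (φ-∙ (v ⁻¹) v)) (trans (φ-cong (inverseˡ v)) φ-ε))

  ▷-∙ : ∀ f u v → f ▷ (u ∙ v) ≈ (f ▷ u) ∙ (f ▷ v)
  ▷-∙ 𝕏       u v = T-∙ u v
  ▷-∙ 𝟘       u v = sym (identityˡ ε)
  ▷-∙ 𝟙       u v = refl
  ▷-∙ (f ⊕ g) u v = trans (∙-cong (▷-∙ f u v) (▷-∙ g u v)) (interchange _ _ _ _)
  ▷-∙ (f ⊗ g) u v = trans (▷-cong f (▷-∙ g u v)) (▷-∙ f _ _)
  ▷-∙ (⊖ f)   u v = trans (⁻¹-cong (▷-∙ f u v)) (sym (⁻¹-∙-comm _ _))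
    where open import Algebra.Properties.AbelianGroup V using (⁻¹-∙-comm)

  module _ (f : Poly) where
    open Additive (f ▷_) (▷-cong f) (▷-∙ f) public renaming (φ-ε to ▷-ε; φ-⁻¹ to ▷-⁻¹)

  ▷-T : ∀ f v → f ▷ T v ≈ T (f ▷ v)
  ▷-T 𝕏       v = refl
  ▷-T 𝟘       v = sym (▷-ε 𝕏)
  ▷-T 𝟙       v = refl
  ▷-T (f ⊕ g) v = trans (∙-cong (▷-T f v) (▷-T g v)) (sym (T-∙ _ _))
  ▷-T (f ⊗ g) v = trans (▷-cong f (▷-T g v)) (▷-T f _)
  ▷-T (⊖ f)   v = trans (⁻¹-cong (▷-T f v)) (sym (▷-⁻¹ 𝕏 _))

  ▷-comm : ∀ f g v → f ▷ g ▷ v ≈ g ▷ f ▷ v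
  ▷-comm 𝕏       g v = sym (▷-T g v)
  ▷-comm 𝟘       g v = sym (▷-ε g)
  ▷-comm 𝟙       g v = refl
  ▷-comm (f ⊕ h) g v = trans (∙-cong (▷-comm f g v) (▷-comm h g v)) (sym (▷-∙ g _ _))
  ▷-comm (f ⊗ h) g v = trans (▷-cong f (▷-comm h g v)) (▷-comm f g _)
  ▷-comm (⊖ f)   g v = trans (⁻¹-cong (▷-comm f g v)) (sym (▷-⁻¹ g _))

  infix 4 _≈[_]_

  -- A record, so that f and g can be inferred from the type.
  record _≈[_]_ (f : Poly) (w : Carrier) (g : Poly) : Set where
    constructor ⌞_⌟
    field agree : f ▷ w ≈ g ▷ w
  open _≈[_]_ public

  -- The quotient of the polynomial ring by the annihilator of w.
  Quotient : Carrier → CommutativeRing 0ℓ 0ℓ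
  Quotient w = record
    { Carrier = Poly
    ; _≈_ = _≈[ w ]_
    ; _+_ = _⊕_
    ; _*_ = _⊗_
    ; -_  = ⊖_
    ; 0#  = 𝟘
    ; 1#  = 𝟙
    ; isCommutativeRing = record
      { isRing = record
        { +-isAbelianGroup = record
          { isGroup = record
            { isMonoid = record
              { isSemigroup = record
                { isMagma = record
                  { isEquivalence = record
                    { refl  = ⌞ refl ⌟
                    ; sym   = λ (⌞ eq ⌟) → ⌞ sym eq ⌟
                    ; trans = λ (⌞ eq₁ ⌟) (⌞ eq₂ ⌟) → ⌞ trans eq₁ eq₂ ⌟
                    }
                  ; ∙-cong = λ (⌞ eq₁ ⌟) (⌞ eq₂ ⌟) → ⌞ ∙-cong eq₁ eq₂ ⌟
                  }
                ; assoc = λ f g h → ⌞ assoc _ _ _ ⌟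
                }
              ; identity = (λ f → ⌞ identityˡ _ ⌟) , (λ f → ⌞ identityʳ _ ⌟)
              }
            ; inverse = (λ f → ⌞ inverseˡ _ ⌟) , (λ f → ⌞ inverseʳ _ ⌟)
            ; ⁻¹-cong = λ (⌞ eq ⌟) → ⌞ ⁻¹-cong eq ⌟
            }
          ; comm = λ f g → ⌞ comm _ _ ⌟
          }
        -- The hypothesis on `f` and `f′` speaks of `w` only, so `f` is first moved past `g′` until
        -- it acts on `w` itself.
        ; *-cong = λ {f} {f′} {g} {g′} (⌞ f≈f′ ⌟) (⌞ g≈g′ ⌟) → ⌞
            trans (▷-cong f g≈g′) (trans (▷-comm f g′ w) (trans (▷-cong g′ f≈f′) (▷-comm g′ f′ w))) ⌟
        ; *-assoc = λ f g h → ⌞ refl ⌟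
        ; *-identity = (λ f → ⌞ refl ⌟) , (λ f → ⌞ refl ⌟)
        ; distrib = (λ f g h → ⌞ ▷-∙ f _ _ ⌟) , (λ f g h → ⌞ refl ⌟)
        }
      ; *-comm = λ f g → ⌞ ▷-comm f g w ⌟
      }
    }

  -- Vectors whose annihilator is a maximal ideal

  module SimpleSubmodule
    {p} (p-prime : Prime p) (p▷v≈ε : ∀ v → constant p ▷ v ≈ ε)
    {m a} (q≡pᵃ : 2 ℕ.+ m ≡ p ℕ.^ a)
    (X^q≈X : ∀ v → 𝕏 ↑ (2 ℕ.+ m) ▷ v ≈ T v)
    (_≟_ : Decidable₂ _≈_)
    where

    q = 2 ℕ.+ m
    q-1 = 1 ℕ.+ m

    module Relations (w : Carrier) where
      private module R = CommutativeRing (Quotient w)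
      open import Algebra.Properties.Monoid.Mult R.+-monoid using () renaming (_×_ to _·_)
      open import Algebra.Properties.Semiring.Exp R.semiring using (_^_)
      open import Algebra.Properties.CommutativeSemiring.Exp R.commutativeSemiring using (^-distrib-*)
      open import Relation.Binary.Reasoning.Setoid R.setoid

      ↑≡^ : ∀ f n → f ↑ n ≡ f ^ n
      ↑≡^ f zero    = ≡.refl
      ↑≡^ f (suc n) = cong (f ⊗_) (↑≡^ f n)

      constant≡· : ∀ n → constant n ≡ n · 𝟙
      constant≡· zero    = ≡.refl
      constant≡· (suc n) = cong (𝟙 ⊕_) (constant≡· n)

      p·1≈0 : p · 𝟙 R.≈ 𝟘
      p·1≈0 = subst (R._≈ 𝟘) (constant≡· p) ⌞ p▷v≈ε w ⌟

      open Characteristic (Quotient w) p-prime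
      open Frobenius p·1≈0 using ([x+y]^pᵃ; 0^pᵃ; [-x]^pᵃ; 1^n)

      -- Induction on the syntax: raising to the power q respects all ring operations in
      -- characteristic p, and at `𝕏` the claim is the hypothesis on the module.
      f^q≈f : ∀ f → f ^ (p ℕ.^ a) R.≈ f
      f^q≈f 𝕏       = subst (R._≈ 𝕏) (≡.trans (↑≡^ 𝕏 q) (cong (𝕏 ^_) q≡pᵃ)) ⌞ X^q≈X w ⌟
      f^q≈f 𝟘       = 0^pᵃ a
      f^q≈f 𝟙       = 1^n (p ℕ.^ a)
      f^q≈f (f ⊕ g) = R.trans ([x+y]^pᵃ a f g) (R.+-cong (f^q≈f f) (f^q≈f g))
      f^q≈f (f ⊗ g) = R.trans (^-distrib-* f g (p ℕ.^ a)) (R.*-cong (f^q≈f f) (f^q≈f g))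
      f^q≈f (⊖ f)   = R.trans ([-x]^pᵃ a f) (R.-‿cong (f^q≈f f))

      f↑q≈f : ∀ f → f ↑ q R.≈ f
      f↑q≈f f = subst (R._≈ f) (≡.sym (≡.trans (↑≡^ f q) (cong (f ^_) q≡pᵃ))) (f^q≈f f)

      f↑[q-1]-idempotent : ∀ f → f ↑ q-1 ⊗ f ↑ q-1 R.≈ f ↑ q-1
      f↑[q-1]-idempotent f = begin
        (f ⊗ f ↑ m) ⊗ f ↑ q-1   ≈⟨ R.*-congʳ (R.*-comm f (f ↑ m)) ⟩
        f ↑ m ⊗ f ⊗ f ↑ q-1     ≈⟨ R.*-assoc (f ↑ m) f (f ↑ q-1) ⟩
        f ↑ m ⊗ f ↑ q           ≈⟨ R.*-congˡ (f↑q≈f f) ⟩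
        f ↑ m ⊗ f               ≈⟨ R.*-comm (f ↑ m) f ⟩
        f ↑ q-1                 ∎

      -- Here `f ↑ m` is an inverse of `f`, because q - 1 = m + 1.
      unit-cancel : ∀ f {g} → f ↑ q-1 R.≈ 𝟙 → f ⊗ g R.≈ 𝟘 → g R.≈ 𝟘
      unit-cancel f {g} unit fg≈0 = begin
        g                 ≈⟨ R.*-identityˡ g ⟨
        𝟙 ⊗ g             ≈⟨ R.*-congʳ unit ⟨
        f ↑ q-1 ⊗ g       ≈⟨ R.*-congʳ (R.*-comm f (f ↑ m)) ⟩
        f ↑ m ⊗ f ⊗ g     ≈⟨ R.*-assoc (f ↑ m) f g ⟩
        f ↑ m ⊗ (f ⊗ g)   ≈⟨ R.*-congˡ fg≈0 ⟩
        f ↑ m ⊗ 𝟘         ≈⟨ R.zeroʳ (f ↑ m) ⟩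
        𝟘                 ∎

      -- Agreement on `w` with a polynomial of degree below n with natural coefficients. For n = q
      -- this will cover every `f`, which leaves finitely many residue classes.
      Spanned : ℕ → Poly → Set
      Spanned n f = ∃[ c ] f R.≈ horner {n} c

      open DifferenceSolver (Quotient w)

      constant-+ : ∀ k l → constant (k ℕ.+ l) R.≈ constant k ⊕ constant l
      constant-+ zero    l = R.sym (R.+-identityˡ _)
      constant-+ (suc k) l = R.trans (R.+-congˡ (constant-+ k l)) (R.sym (R.+-assoc 𝟙 _ _))

      constant-* : ∀ k l → constant (k ℕ.* l) R.≈ constant k ⊗ constant l
      constant-* zero    l = R.sym (R.zeroˡ _)
      constant-* (suc k) l = R.trans (constant-+ l (k ℕ.* l))
        (R.trans (R.+-cong (R.sym (R.*-identityˡ _)) (constant-* k l)) (R.sym (R.distribʳ (constant l) 𝟙 (constant k))))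

      horner-+ : ∀ {n} (c d : Fin n → ℕ) → horner c ⊕ horner d R.≈ horner (λ i → c i ℕ.+ d i)
      horner-+ {zero}  c d = R.+-identityˡ 𝟘
      horner-+ {suc n} c d = R.trans
        (solve 5 (λ k l x f g → (k :+ x :* f) :+ (l :+ x :* g) := (k :+ l) :+ x :* (f :+ g)) R.refl
           (constant (c zero)) (constant (d zero)) 𝕏 (horner (c ∘ suc)) (horner (d ∘ suc)))
        (R.+-cong (R.sym (constant-+ (c zero) (d zero))) (R.*-congˡ (horner-+ (c ∘ suc) (d ∘ suc))))

      horner-scale : ∀ {n} k (c : Fin n → ℕ) → constant k ⊗ horner c R.≈ horner (λ i → k ℕ.* c i)
      horner-scale {zero}  k c = R.zeroʳ _
      horner-scale {suc n} k c = R.trans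
        (solve 4 (λ k l x f → k :* (l :+ x :* f) := k :* l :+ x :* (k :* f)) R.refl
           (constant k) (constant (c zero)) 𝕏 (horner (c ∘ suc)))
        (R.+-cong (R.sym (constant-* k (c zero))) (R.*-congˡ (horner-scale k (c ∘ suc))))

      horner-snoc : ∀ {n} (c : Fin (suc n) → ℕ) →
                    horner c R.≈ horner (c ∘ inject₁) ⊕ constant (c (fromℕ n)) ⊗ 𝕏 ↑ n
      horner-snoc {zero}  c =
        solve 2 (λ k x → k :+ x :* :0 := :0 :+ k :* :1) R.refl (constant (c zero)) 𝕏
      horner-snoc {suc n} c = R.trans (R.+-congˡ (R.*-congˡ (horner-snoc (c ∘ suc))))
        (solve 5 (λ k l x f y → k :+ x :* (f :+ l :* y) := (k :+ x :* f) :+ l :* (x :* y)) R.refl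
           (constant (c zero)) (constant (c (fromℕ (suc n)))) 𝕏 (horner (c ∘ suc ∘ inject₁)) (𝕏 ↑ n))

      spanned-≈ : ∀ {n f g} → f R.≈ g → Spanned n g → Spanned n f
      spanned-≈ f≈g (c , eq) = c , R.trans f≈g eq

      spanned-+ : ∀ {n f g} → Spanned n f → Spanned n g → Spanned n (f ⊕ g)
      spanned-+ (c , f≈) (d , g≈) = _ , R.trans (R.+-cong f≈ g≈) (horner-+ c d)

      spanned-scale : ∀ {n f} k → Spanned n f → Spanned n (constant k ⊗ f)
      spanned-scale k (c , f≈) = _ , R.trans (R.*-congˡ f≈) (horner-scale k c)

      spanned-suc : ∀ {n f} → Spanned n f → Spanned (suc n) (𝕏 ⊗ f)
      spanned-suc (c , f≈) = (λ { zero → 0 ; (suc i) → c i }) ,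
        R.trans (R.*-congˡ f≈) (R.sym (R.+-identityˡ _))

      spanned-0 : ∀ {n} → Spanned n 𝟘
      spanned-0 = (λ _ → 0) , vanishes _
        where
        vanishes : ∀ n → 𝟘 R.≈ horner {n} (λ _ → 0)
        vanishes zero    = R.refl
        vanishes (suc n) = R.sym (R.trans (R.+-identityˡ _)
                             (R.trans (R.*-congˡ (R.sym (vanishes n))) (R.zeroʳ 𝕏)))

      spanned-1 : ∀ {n} → Spanned (suc n) 𝟙
      spanned-1 {n} with spanned-0 {n}
      ... | c , 0≈ = (λ { zero → 1 ; (suc i) → c i }) , (begin
        𝟙                             ≈⟨ solve 1 (λ x → :1 := (:1 :+ :0) :+ x :* :0) R.refl 𝕏 ⟩
        constant 1 ⊕ 𝕏 ⊗ 𝟘            ≈⟨ R.+-congˡ (R.*-congˡ 0≈) ⟩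
        constant 1 ⊕ 𝕏 ⊗ horner c     ∎)

      spanned-X : Spanned q 𝕏
      spanned-X = spanned-≈ (R.sym (R.*-identityʳ 𝕏)) (spanned-suc spanned-1)

      -- Multiplication by X raises the degree to q at most; the top term is split off, and its X^q
      -- is replaced by X.
      spanned-X* : ∀ {f} → Spanned q f → Spanned q (𝕏 ⊗ f)
      spanned-X* {f} (c , f≈) = spanned-≈ (begin
        𝕏 ⊗ f
          ≈⟨ R.*-congˡ (R.trans f≈ (horner-snoc c)) ⟩
        𝕏 ⊗ (horner (c ∘ inject₁) ⊕ constant (c (fromℕ q-1)) ⊗ 𝕏 ↑ q-1)
          ≈⟨ solve 4 (λ x h k y → x :* (h :+ k :* y) := x :* h :+ k :* (x :* y)) R.refl
               𝕏 (horner (c ∘ inject₁)) (constant (c (fromℕ q-1))) (𝕏 ↑ q-1) ⟩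
        𝕏 ⊗ horner (c ∘ inject₁) ⊕ constant (c (fromℕ q-1)) ⊗ 𝕏 ↑ q
          ≈⟨ R.+-congˡ (R.*-congˡ ⌞ X^q≈X w ⌟) ⟩
        𝕏 ⊗ horner (c ∘ inject₁) ⊕ constant (c (fromℕ q-1)) ⊗ 𝕏 ∎)
        (spanned-+ (spanned-suc (c ∘ inject₁ , R.refl)) (spanned-scale (c (fromℕ q-1)) spanned-X))

      spanned-* : ∀ {f g} → Spanned q f → Spanned q g → Spanned q (f ⊗ g)
      spanned-* {f} {g} (c , f≈) g-spanned = spanned-≈ (R.*-congʳ f≈) (horner* c)
        where
        horner* : ∀ {n} (c : Fin n → ℕ) → Spanned q (horner c ⊗ g)
        horner* {zero}  c = spanned-≈ (R.zeroˡ g) spanned-0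
        horner* {suc n} c = spanned-≈
          (solve 4 (λ k x h g → (k :+ x :* h) :* g := k :* g :+ x :* (h :* g)) R.refl
             (constant (c zero)) 𝕏 (horner (c ∘ suc)) g)
          (spanned-+ (spanned-scale (c zero) g-spanned) (spanned-X* (horner* (c ∘ suc))))

      spanned : ∀ f → Spanned q f
      spanned 𝕏       = spanned-X
      spanned 𝟘       = spanned-0
      spanned 𝟙       = spanned-1
      spanned (f ⊕ g) = spanned-+ (spanned f) (spanned g)
      spanned (f ⊗ g) = spanned-* (spanned f) (spanned g)
      -- Coefficients are natural numbers, so negation is expressed as multiplication by p - 1.
      spanned (⊖ f)   = spanned-≈ negate (spanned-scale (ℕ.pred p) (spanned f))
        where
        open import Algebra.Properties.Group R.+-group using (inverseʳ-unique)
        negate : ⊖ f R.≈ constant (ℕ.pred p) ⊗ f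
        negate = R.sym (inverseʳ-unique _ _ (begin
          f ⊕ constant (ℕ.pred p) ⊗ f
            ≈⟨ solve 2 (λ f k → f :+ k :* f := (:1 :+ k) :* f) R.refl f (constant (ℕ.pred p)) ⟩
          constant (suc (ℕ.pred p)) ⊗ f
            ≡⟨ cong (λ n → constant n ⊗ f) (ℕ.suc-pred p {{prime⇒nonZero p-prime}}) ⟩
          constant p ⊗ f
            ≈⟨ R.*-congʳ ⌞ p▷v≈ε w ⌟ ⟩
          𝟘 ⊗ f
            ≈⟨ R.zeroˡ f ⟩
          𝟘 ∎))

      constant-% : ∀ n → constant n R.≈ constant (toℕ ((n mod p) {{prime⇒nonZero p-prime}}))
      constant-% n = begin
        constant n
          ≡⟨ cong constant (m≡m%n+[m/n]*n n p) ⟩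
        constant (n % p ℕ.+ n / p ℕ.* p)
          ≈⟨ R.trans (constant-+ (n % p) _) (R.+-congˡ (constant-* (n / p) p)) ⟩
        constant (n % p) ⊕ constant (n / p) ⊗ constant p
          ≈⟨ R.+-congˡ (R.trans (R.*-congˡ ⌞ p▷v≈ε w ⌟) (R.zeroʳ _)) ⟩
        constant (n % p) ⊕ 𝟘
          ≈⟨ R.+-identityʳ _ ⟩
        constant (n % p)
          ≡⟨ cong constant (Fin.toℕ-fromℕ< (m%n<n n p)) ⟨
        constant (toℕ (n mod p)) ∎
        where instance _ = prime⇒nonZero p-prime

      horner-cong : ∀ {n} (c d : Fin n → ℕ) → (∀ i → constant (c i) R.≈ constant (d i)) → horner c R.≈ horner d
      horner-cong {zero}  c d eq = R.refl
      horner-cong {suc n} c d eq = R.+-cong (eq zero) (R.*-congˡ (horner-cong (c ∘ suc) (d ∘ suc) (eq ∘ suc)))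

    -- Degree below q and coefficients below p. The list does not depend on the vector, so it stays
    -- valid while `decide` replaces one vector by another.
    representative : Fin (p ℕ.^ q) → Poly
    representative i = horner (λ j → toℕ (finToFun {p} {q} i j))

    represented : ∀ w f → ∃[ i ] f ≈[ w ] representative i
    represented w f with Relations.spanned w f
    ... | c , f≈ = funToFin {q} {p} c% , R.trans f≈ (Relations.horner-cong w c _ λ i →
        R.trans (Relations.constant-% w (c i))
          (R.reflexive (cong (constant ∘ toℕ) (≡.sym (Fin.finToFun-funToFin c% i)))))
      where
      module R = CommutativeRing (Quotient w)
      instance _ = prime⇒nonZero p-prime
      c% : Fin q → Fin p
      c% j = c j mod p

    Decided : Carrier → Poly → Set
    Decided w f = f ▷ w ≈ ε ⊎ f ↑ q-1 ▷ w ≈ w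

    -- Both alternatives pass from `w` to `g ▷ w` because polynomials commute. Hence decisions
    -- already made survive when a later polynomial changes the vector.
    decided-▷ : ∀ {w} f g → Decided w f → Decided (g ▷ w) f
    decided-▷ {w} f g (inj₁ fw≈ε) = inj₁ (trans (▷-comm f g w) (trans (▷-cong g fw≈ε) (▷-ε g)))
    decided-▷ {w} f g (inj₂ unit) = inj₂ (trans (▷-comm (f ↑ q-1) g w) (▷-cong g unit))

    unit-part : ∀ {w} f → f ▷ w ≉ ε → f ↑ q-1 ▷ w ≉ ε
    unit-part {w} f f≉0 eq = f≉0 (trans (sym (agree (Relations.f↑q≈f w f))) (trans (▷-cong f eq) (▷-ε f)))

    decide : ∀ {n} (f : Fin n → Poly) {w} → w ≉ ε → ∃[ g ] (g ▷ w ≉ ε × ∀ i → Decided (g ▷ w) (f i))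
    decide {zero}  f {w} w≉0 = 𝟙 , w≉0 , λ ()
    decide {suc n} f {w} w≉0 with decide (f ∘ suc) w≉0
    ... | g , gw≉0 , decided with (f zero ▷ g ▷ w) ≟ ε
    ...   | yes fgw≈ε = g , gw≉0 , λ { zero → inj₁ fgw≈ε ; (suc i) → decided i }
    ...   | no  fgw≉ε = f zero ↑ q-1 ⊗ g , unit-part (f zero) fgw≉ε , λ
      { zero    → inj₂ (agree (Relations.f↑[q-1]-idempotent (g ▷ w) (f zero)))
      ; (suc i) → decided-▷ (f (suc i)) (f zero ↑ q-1) (decided i)
      }

    Cancellative : Carrier → Set
    Cancellative w = ∀ {f g} → f ⊗ g ≈[ w ] 𝟘 → ¬ f ≈[ w ] 𝟘 → g ≈[ w ] 𝟘

    decided⇒cancellative : ∀ w → (∀ i → Decided w (representative i)) → Cancellative w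
    decided⇒cancellative w decided {f} {g} fg≈0 f≉0 = by-cases (represented w f)
      where
      module R = CommutativeRing (Quotient w)
      by-cases : ∃[ i ] f ≈[ w ] representative i → g ≈[ w ] 𝟘
      by-cases (i , f≈r) with decided i
      ... | inj₁ r≈0  = contradiction (R.trans f≈r ⌞ r≈0 ⌟) f≉0
      ... | inj₂ unit = Relations.unit-cancel w (representative i) ⌞ unit ⌟
                          (R.trans (R.*-congʳ (R.sym f≈r)) fg≈0)

    -- The vector v generates a simple submodule on which u acts invertibly.
    field-quotient : ∀ u w → u ▷ w ≉ ε → ∃[ v ] (¬ 𝟙 ≈[ v ] 𝟘 × ¬ u ≈[ v ] 𝟘 × Cancellative v)
    field-quotient u w uw≉0 = by-choice (decide representative (unit-part u uw≉0))
      where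
      -- Applying the idempotent of `u` first makes `u ↑ q-1` fix `w₁`, and so every `g ▷ w₁`; then
      -- `u` cannot kill the vector chosen in the end.
      w₁ = u ↑ q-1 ▷ w
      by-choice : ∃[ g ] (g ▷ w₁ ≉ ε × ∀ i → Decided (g ▷ w₁) (representative i)) →
                  ∃[ v ] (¬ 𝟙 ≈[ v ] 𝟘 × ¬ u ≈[ v ] 𝟘 × Cancellative v)
      by-choice (g , v≉ε , decided) = g ▷ w₁ , (λ (⌞ v≈ε ⌟) → v≉ε v≈ε) , u≉0 , decided⇒cancellative (g ▷ w₁) decided
        where
        module R = CommutativeRing (Quotient (g ▷ w₁))
        open import Relation.Binary.Reasoning.Setoid setoid
        u≉0 : ¬ u ≈[ g ▷ w₁ ] 𝟘
        u≉0 u≈0 = v≉ε (begin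
          g ▷ w₁                ≈⟨ ▷-cong g (agree (Relations.f↑[q-1]-idempotent w u)) ⟨
          g ▷ u ↑ q-1 ▷ w₁      ≈⟨ ▷-comm (u ↑ q-1) g w₁ ⟨
          u ↑ q-1 ▷ g ▷ w₁      ≈⟨ agree (R.trans (R.*-congʳ {u ↑ m} u≈0) (R.zeroˡ (u ↑ m))) ⟩
          ε                     ∎)

record FiniteField (q : ℕ) : Set₁ where
  infix 4 _≟_
  field
    ring : CommutativeRing 0ℓ 0ℓ
  open CommutativeRing ring using (Carrier; _≈_; 0#; 1#) renaming (_*_ to _·_)
  field
    _≟_                : Decidable₂ _≈_
    cancel             : ∀ {x y} → x · y ≈ 0# → ¬ x ≈ 0# → y ≈ 0#
    1≉0                : ¬ 1# ≈ 0#
    element            : Fin q → Carrier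
    element-injective  : ∀ {i j} → element i ≈ element j → i ≡ j
    element-surjective : ∀ y → ∃[ i ] element i ≈ y

-- The sequences over ℤ/p satisfying s (n + q) = s (n + 1), with the shift, form a
-- module over ℤ/p[X]/(X^q − X).
module RecurrentSequences {p} (p-prime : Prime p) (m a : ℕ) (q≡pᵃ : 2 ℕ.+ m ≡ p ℕ.^ suc a) where
  open import Data.Nat using (_+_; _*_)

  private instance
    p≢0 : NonZero p
    p≢0 = prime⇒nonZero p-prime

  q = 2 + m

  infix 4 _≡ₚ_
  _≡ₚ_ : ℕ → ℕ → Set
  x ≡ₚ y = x % p ≡ y % p

  +-congₚ : ∀ {x x′ y y′} → x ≡ₚ x′ → y ≡ₚ y′ → x + y ≡ₚ x′ + y′
  +-congₚ {x} {x′} {y} {y′} x≡ y≡ = ≡.trans (%-distribˡ-+ x y p)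
    (≡.trans (cong₂ (λ u v → (u + v) % p) x≡ y≡) (≡.sym (%-distribˡ-+ x′ y′ p)))

  *-congₚ : ∀ c {x y} → x ≡ₚ y → c * x ≡ₚ c * y
  *-congₚ c {x} {y} x≡y = ≡.trans (%-distribˡ-* c x p)
    (≡.trans (cong (λ u → (c % p * u) % p) x≡y) (≡.sym (%-distribˡ-* c y p)))

  p*≡0 : ∀ x → p * x ≡ₚ 0
  p*≡0 x = ≡.trans (cong (_% p) (ℕ.*-comm p x)) (≡.trans (m*n%n≡0 x p) (≡.sym (m*n%n≡0 0 p)))

  negate-inverse : ∀ x → pred p * x + x ≡ₚ 0
  negate-inverse x = ≡.trans (cong (_% p) (≡.trans (ℕ.+-comm _ x) (cong (_* x) (ℕ.suc-pred p)))) (p*≡0 x)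

  -- Terms are natural numbers compared modulo p; the additive inverse is multiplication by
  -- `pred p`.
  record Sequence : Set where
    field
      at        : ℕ → ℕ
      recurrent : ∀ n → at (n + q) ≡ₚ at (suc n)
  open Sequence

  infix 4 _≋_
  _≋_ : Sequence → Sequence → Set
  s ≋ t = ∀ n → at s n ≡ₚ at t n

  sequences : AbelianGroup 0ℓ 0ℓ
  sequences = record
    { Carrier = Sequence
    ; _≈_     = _≋_
    ; _∙_     = λ s t → record
      { at        = λ n → at s n + at t n
      ; recurrent = λ n → +-congₚ {at s (n + q)} (recurrent s n) (recurrent t n)
      }
    ; ε       = record { at = λ _ → 0 ; recurrent = λ _ → ≡.refl }
    ; _⁻¹     = λ s → record
      { at        = λ n → pred p * at s n
      ; recurrent = λ n → *-congₚ (pred p) {at s (n + q)} (recurrent s n)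
      }
    ; isAbelianGroup = record
      { isGroup = record
        { isMonoid = record
          { isSemigroup = record
            { isMagma = record
              { isEquivalence = record
                { refl  = λ n → ≡.refl
                ; sym   = λ s≋t n → ≡.sym (s≋t n)
                ; trans = λ s≋t t≋u n → ≡.trans (s≋t n) (t≋u n)
                }
              ; ∙-cong = λ {s} s≋s′ t≋t′ n → +-congₚ {at s n} (s≋s′ n) (t≋t′ n)
              }
            ; assoc = λ s t u n → cong (_% p) (ℕ.+-assoc (at s n) (at t n) (at u n))
            }
          ; identity = (λ s n → ≡.refl) , (λ s n → cong (_% p) (ℕ.+-identityʳ (at s n)))
          }
        ; inverse = (λ s n → negate-inverse (at s n))
                  , (λ s n → ≡.trans (cong (_% p) (ℕ.+-comm (at s n) _)) (negate-inverse (at s n)))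
        ; ⁻¹-cong = λ {s} s≋t n → *-congₚ (pred p) {at s n} (s≋t n)
        }
      ; comm = λ s t n → cong (_% p) (ℕ.+-comm (at s n) (at t n))
      }
    }

  shift : Endomorphism sequences
  shift = record
    { T      = λ s → record { at = at s ∘ suc ; recurrent = recurrent s ∘ suc }
    ; T-cong = λ s≋t n → s≋t (suc n)
    ; T-∙    = λ s t n → ≡.refl
    }

  open Action shift

  infix 4 _≋?_
  -- The first q terms determine a sequence, because the recurrence expresses term n as the earlier
  -- term n - q + 1.
  _≋?_ : Decidable₂ _≋_
  s ≋? t = map′ extend (λ s≋t i → s≋t (toℕ i))
                (Fin.all? {q} λ i → at s (toℕ i) % p ℕ.≟ at t (toℕ i) % p)
    where
    extend : (∀ (i : Fin q) → at s (toℕ i) ≡ₚ at t (toℕ i)) → s ≋ t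
    extend prefix = <-rec _ λ n rec → step n rec (n ℕ.<? q)
      where
      step : ∀ n → (∀ {k} → k < n → at s k ≡ₚ at t k) → Dec (n < q) → at s n ≡ₚ at t n
      step n rec (yes n<q) = subst (λ k → at s k ≡ₚ at t k) (Fin.toℕ-fromℕ< n<q) (prefix (fromℕ< n<q))
      step n rec (no  n≮q) = subst (λ k → at s k ≡ₚ at t k) (ℕ.m∸n+n≡m (ℕ.≮⇒≥ n≮q))
        (≡.trans (recurrent s (n ∸ q)) (≡.trans (rec smaller) (≡.sym (recurrent t (n ∸ q)))))
        where
        smaller : suc (n ∸ q) < n
        smaller = subst (suc (n ∸ q) <_) (ℕ.m∸n+n≡m (ℕ.≮⇒≥ n≮q))
          (subst (_< n ∸ q + q) (ℕ.+-comm (n ∸ q) 1) (ℕ.+-monoʳ-< (n ∸ q) {1} {q} (s≤s (s≤s z≤n))))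

  𝕏↑-shifts : ∀ k s n → at (𝕏 ↑ k ▷ s) n ≡ at s (k + n)
  𝕏↑-shifts zero    s n = ≡.refl
  𝕏↑-shifts (suc k) s n = ≡.trans (𝕏↑-shifts k s (suc n)) (cong (at s) (ℕ.+-suc k n))

  constant-scales : ∀ k s n → at (constant k ▷ s) n ≡ k * at s n
  constant-scales zero    s n = ≡.refl
  constant-scales (suc k) s n = cong (at s n +_) (constant-scales k s n)

  p▷s≋0 : ∀ s → constant p ▷ s ≋ AbelianGroup.ε sequences
  p▷s≋0 s n = ≡.trans (cong (_% p) (constant-scales p s n)) (p*≡0 (at s n))

  X^q≋X : ∀ s → 𝕏 ↑ q ▷ s ≋ 𝕏 ▷ s
  X^q≋X s n = ≡.trans (cong (_% p) (≡.trans (𝕏↑-shifts q s n) (cong (at s) (ℕ.+-comm q n)))) (recurrent s n)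

  open SimpleSubmodule p-prime p▷s≋0 {m} {suc a} q≡pᵃ X^q≋X _≋?_ hiding (q)

  indicator : ∀ {A : Set} → Dec A → ℕ
  indicator (yes _) = 1
  indicator (no  _) = 0

  -- Zero at the indices 0, ..., m and one at m + 1 = q - 1. The recurrence asks for period q - 1
  -- from index 1 onwards and leaves the term at 0 free. No polynomial that is monic of degree below
  -- q in the sense of `Monic` can kill it.
  impulse : Sequence
  impulse = record { at = value ; recurrent = value-recurrent }
    where
    value : ℕ → ℕ
    value zero    = 0
    value (suc n) = indicator (n % suc m ℕ.≟ m)
    value-recurrent : ∀ n → value (n + q) ≡ₚ value (suc n)
    value-recurrent n = ≡.trans (cong (λ k → value k % p) (ℕ.+-suc n (suc m)))
      (cong (λ r → indicator (r ℕ.≟ m) % p) ([m+n]%n≡m%n n (suc m)))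

  impulse-low : ∀ n → n < suc m → at impulse n ≡ 0
  impulse-low zero    _ = ≡.refl
  impulse-low (suc n) (s≤s n<m) with n % suc m ℕ.≟ m
  ... | yes eq = contradiction (≡.trans (≡.sym (m<n⇒m%n≡m (ℕ.m<n⇒m<1+n n<m))) eq) (ℕ.<⇒≢ n<m)
  ... | no  _  = ≡.refl

  impulse-top : at impulse (suc m) ≡ 1
  impulse-top with m % suc m ℕ.≟ m
  ... | yes _   = ≡.refl
  ... | no  neq = contradiction (m<n⇒m%n≡m (ℕ.n<1+n m)) neq

  -- f acts like a monic polynomial of degree d on the first nonzero term.
  Monic : ℕ → Poly → Set
  Monic d f = ∀ s n → (∀ j → j < n + d → at s j ≡ₚ 0) → at (f ▷ s) n ≡ₚ at s (n + d)

  monic-1 : Monic 0 𝟙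
  monic-1 s n _ = cong (λ k → at s k % p) (≡.sym (ℕ.+-identityʳ n))

  -- Applying `g-monic` at each index up to n + d shows that `g ▷ s` vanishes below n + d, as
  -- `f-monic` requires, and identifies its term there.
  monic-⊗ : ∀ {d e} f g → Monic d f → Monic e g → Monic (d + e) (f ⊗ g)
  monic-⊗ {d} {e} f g f-monic g-monic s n low = ≡.trans
    (f-monic (g ▷ s) n λ j j<n+d → ≡.trans (reduce j (ℕ.<⇒≤ j<n+d)) (low (j + e) (bound j<n+d)))
    (≡.trans (reduce (n + d) ℕ.≤-refl) (cong (λ k → at s k % p) (ℕ.+-assoc n d e)))
    where
    bound : ∀ {j} → j < n + d → j + e < n + (d + e)
    bound {j} j<n+d = subst (j + e <_) (ℕ.+-assoc n d e) (ℕ.+-monoˡ-< e j<n+d)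
    reduce : ∀ j → j ≤ n + d → at (g ▷ s) j ≡ₚ at s (j + e)
    reduce j j≤n+d = g-monic s j λ i i<j+e → low i
      (ℕ.<-≤-trans i<j+e (subst (j + e ≤_) (ℕ.+-assoc n d e) (ℕ.+-monoˡ-≤ e j≤n+d)))

  -- With 1 < k the subtracted term, at index n + 1, is among those assumed to vanish.
  monic-X^k-X : ∀ k → 1 < k → Monic k (𝕏 ↑ k ⊕ ⊖ 𝕏)
  monic-X^k-X k 1<k s n low = begin
    (at (𝕏 ↑ k ▷ s) n + pred p * at s (suc n)) % p
      ≡⟨ +-congₚ (cong (_% p) (≡.trans (𝕏↑-shifts k s n) (cong (at s) (ℕ.+-comm k n))))
                 (*-congₚ (pred p) (low (suc n) (subst (_< n + k) (ℕ.+-comm n 1) (ℕ.+-monoʳ-< n 1<k)))) ⟩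
    (at s (n + k) + pred p * 0) % p
      ≡⟨ cong (λ x → (at s (n + k) + x) % p) (ℕ.*-zeroʳ (pred p)) ⟩
    (at s (n + k) + 0) % p
      ≡⟨ cong (_% p) (ℕ.+-identityʳ _) ⟩
    at s (n + k) % p ∎
    where open ≡.≡-Reasoning

  -- An element of the field with p^(e + 1) elements generates it unless it is a root of
  -- subfields e.
  subfields : ℕ → Poly
  subfields zero    = 𝟙
  subfields (suc d) = (𝕏 ↑ (p ℕ.^ suc d) ⊕ ⊖ 𝕏) ⊗ subfields d

  subfields-degree : ℕ → ℕ
  subfields-degree zero    = 0
  subfields-degree (suc d) = p ℕ.^ suc d + subfields-degree d

  1<p : 1 < p
  1<p = ℕ.nonTrivial⇒n>1 p {{prime⇒nonTrivial p-prime}}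

  subfields-monic : ∀ d → Monic (subfields-degree d) (subfields d)
  subfields-monic zero    = monic-1
  subfields-monic (suc d) = monic-⊗ (𝕏 ↑ (p ℕ.^ suc d) ⊕ ⊖ 𝕏) (subfields d)
    (monic-X^k-X (p ℕ.^ suc d) (ℕ.<-≤-trans 1<p (ℕ.m≤m*n p (p ℕ.^ d) {{ℕ.m^n≢0 p d}})))
    (subfields-monic d)

  -- A geometric sum: each step needs only that twice p^(d + 1) is at most p^(d + 2).
  subfields-degree-bound : ∀ d → subfields-degree d < p ℕ.^ suc d
  subfields-degree-bound zero    = ℕ.≤-trans (s≤s z≤n) (ℕ.≤-trans 1<p (ℕ.≤-reflexive (≡.sym (ℕ.*-identityʳ p))))
  subfields-degree-bound (suc d) = ℕ.<-≤-trans
    (ℕ.+-monoʳ-< (p ℕ.^ suc d) (subfields-degree-bound d))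
    (subst (_≤ p * p ℕ.^ suc d) (cong (p ℕ.^ suc d +_) (ℕ.+-identityʳ _))
           (ℕ.*-monoˡ-≤ (p ℕ.^ suc d) 1<p))

  -- The degree D is at most q - 1, so the term of the image at q - 1 - D is the term of `impulse`
  -- at q - 1, which is 1.
  subfields▷impulse≉0 : ¬ subfields a ▷ impulse ≋ AbelianGroup.ε sequences
  subfields▷impulse≉0 eq = contradiction 1≡ₚ0 1≢ₚ0
    where
    D = subfields-degree a
    D≤ : D ≤ suc m
    D≤ = ℕ.s≤s⁻¹ (subst (D <_) (≡.sym q≡pᵃ) (subfields-degree-bound a))
    n+D : suc m ∸ D + D ≡ suc m
    n+D = ℕ.m∸n+n≡m D≤
    1≡ₚ0 : 1 ≡ₚ 0
    1≡ₚ0 = begin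
      1 % p                                      ≡⟨ cong (_% p) impulse-top ⟨
      at impulse (suc m) % p                     ≡⟨ cong (λ k → at impulse k % p) n+D ⟨
      at impulse (suc m ∸ D + D) % p             ≡⟨ subfields-monic a impulse (suc m ∸ D)
                                                      (λ j j< → cong (_% p) (impulse-low j (subst (j <_) n+D j<))) ⟨
      at (subfields a ▷ impulse) (suc m ∸ D) % p ≡⟨ eq (suc m ∸ D) ⟩
      0 % p                                      ∎
      where open ≡.≡-Reasoning
    1≢ₚ0 : ¬ 1 ≡ₚ 0
    1≢ₚ0 e = contradiction (≡.trans (≡.sym (m<n⇒m%n≡m 1<p)) (≡.trans e (m*n%n≡0 0 p))) λ ()

  -- The factor for d occurs in the product and vanishes on `v`.
  subfields-vanish : ∀ v {d} → 𝕏 ↑ (p ℕ.^ suc d) ≈[ v ] 𝕏 → ∀ {e} → d < e → subfields e ≈[ v ] 𝟘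
  subfields-vanish v {d} eq {suc e} d≤e with ℕ.m<1+n⇒m<n∨m≡n d≤e
  ... | inj₁ d<e  = R.trans (R.*-congˡ (subfields-vanish v eq d<e)) (R.zeroʳ (𝕏 ↑ (p ℕ.^ suc e) ⊕ ⊖ 𝕏))
    where module R = CommutativeRing (Quotient v)
  ... | inj₂ ≡.refl = R.trans (R.*-congʳ (x≈y⇒x∙y⁻¹≈ε eq)) (R.zeroˡ (subfields e))
    where
    module R = CommutativeRing (Quotient v)
    open import Algebra.Properties.Group R.+-group using (x≈y⇒x∙y⁻¹≈ε)

  field-of-order-pᵃ : FiniteField (p ℕ.^ suc a)
  field-of-order-pᵃ = build (field-quotient (subfields a) impulse subfields▷impulse≉0)
    where
    build : ∃[ v ] (¬ 𝟙 ≈[ v ] 𝟘 × ¬ subfields a ≈[ v ] 𝟘 × Cancellative v) → FiniteField (p ℕ.^ suc a)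
    build (v , 1≉0 , u≉0 , cancellative) = record
      { ring               = Quotient v
      ; _≟_                = _≈?_
      ; cancel             = cancel
      ; 1≉0                = 1≉0
      ; element            = element
      ; element-injective  = element-injective
      ; element-surjective = element-surjective
      }
      where
      open CommutativeRing (Quotient v) using (semiring)
      open import Algebra.Properties.Semiring.Exp semiring using (_^_)
      _≈?_ : Decidable₂ _≈[ v ]_
      f ≈? g = map′ ⌞_⌟ agree ((f ▷ v) ≋? (g ▷ v))
      cancel : Cancellative v
      cancel {f} = cancellative {f}
      𝕏-generates : ∀ d → d < a → ¬ 𝕏 ^ (p ℕ.^ suc d) ≈[ v ] 𝕏
      𝕏-generates d d<a eq =
        u≉0 (subfields-vanish v (subst (_≈[ v ] 𝕏) (≡.sym (Relations.↑≡^ v 𝕏 (p ℕ.^ suc d))) eq) d<a)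
      open PolynomialFunctions (Quotient v)
      open Enumeration _≈?_ cancel 1≉0 p-prime (Relations.p·1≈0 v) {a} (Relations.f^q≈f v) 𝕏 𝕏-generates

finite-field : ∀ {q} → IsPrimePower q → FiniteField q
finite-field (p , suc a , p-prime , _ , ≡.refl) =
  RecurrentSequences.field-of-order-pᵃ p-prime (p ℕ.^ suc a ∸ 2) a (ℕ.m+[n∸m]≡n 2≤q)
  where
  2≤q : 2 ≤ p ℕ.^ suc a
  2≤q = ℕ.≤-trans (ℕ.nonTrivial⇒n>1 p {{prime⇒nonTrivial p-prime}})
                  (ℕ.m≤m*n p (p ℕ.^ a) {{ℕ.m^n≢0 p a {{prime⇒nonZero p-prime}}}})

-- Regularity and decidability for finite graphs

members : ∀ {n} (s : Subset n) → Fin ∣ s ∣ → Fin n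
members (true  ∷ s) zero    = zero
members (true  ∷ s) (suc i) = suc (members s i)
members (false ∷ s) i       = suc (members s i)

members-injective : ∀ {n} (s : Subset n) → Injective _≡_ _≡_ (members s)
members-injective (true  ∷ s) {zero}  {zero}  eq = ≡.refl
members-injective (true  ∷ s) {suc i} {suc j} eq = cong suc (members-injective s (Fin.suc-injective eq))
members-injective (false ∷ s) eq = members-injective s (Fin.suc-injective eq)

members-sound : ∀ {n} (s : Subset n) i → lookup s (members s i) ≡ true
members-sound (true  ∷ s) zero    = ≡.refl
members-sound (true  ∷ s) (suc i) = members-sound s i
members-sound (false ∷ s) i       = members-sound s i

members-complete : ∀ {n} (s : Subset n) x → lookup s x ≡ true → ∃[ i ] members s i ≡ x
members-complete (true  ∷ s) zero    _ = zero , ≡.refl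
members-complete (true  ∷ s) (suc x) e with members-complete s x e
... | i , eq = suc i , cong suc eq
members-complete (false ∷ s) (suc x) e with members-complete s x e
... | i , eq = i , cong suc eq

-- Since `members` lists the subset without repetition, the two listings inject into each other.
card-enumerated : ∀ {n k} (s : Subset n) (f : Fin k → Fin n) → Injective _≡_ _≡_ f →
                  (∀ i → lookup s (f i) ≡ true) → (∀ x → lookup s x ≡ true → ∃[ i ] f i ≡ x) →
                  ∣ s ∣ ≡ k
card-enumerated s f f-injective sound complete = ℕ.≤-antisym
  (Fin.injective⇒≤ {f = λ i → proj₁ (back i)} λ {i} {j} eq → members-injective s
    (≡.trans (≡.sym (proj₂ (back i))) (≡.trans (cong f eq) (proj₂ (back j)))))
  (Fin.injective⇒≤ {f = λ i → proj₁ (forth i)} λ {i} {j} eq → f-injective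
    (≡.trans (≡.sym (proj₂ (forth i))) (≡.trans (cong (members s) eq) (proj₂ (forth j)))))
  where
  back : ∀ i → ∃[ j ] f j ≡ members s i
  back i = complete (members s i) (members-sound s i)
  forth : ∀ i → ∃[ j ] members s j ≡ f i
  forth i = members-complete s (f i) (sound i)

module FromRelation {V : Set} {n} (iso : Fin n ↔ V)
  {_~_ : V → V → Set} (_~?_ : Decidable₂ _~_)
  (~-sym : ∀ x y → x ~ y → y ~ x) (~-irrefl : ∀ x → ¬ x ~ x) where

  open Inverse iso public using () renaming (to to decode; from to encode)

  decode∘encode : ∀ x → decode (encode x) ≡ x
  decode∘encode x = Inverse.inverseˡ iso ≡.refl

  decode-injective : ∀ {i j} → decode i ≡ decode j → i ≡ j
  decode-injective eq = ≡.trans (≡.sym (Inverse.inverseʳ iso ≡.refl)) (≡.trans (cong encode eq) (Inverse.inverseʳ iso ≡.refl))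

  encode-injective : ∀ {x y} → encode x ≡ encode y → x ≡ y
  encode-injective eq = ≡.trans (≡.sym (decode∘encode _)) (≡.trans (cong decode eq) (decode∘encode _))

  G : Graph n
  G = record
    { adj       = λ i j → does (decode i ~? decode j)
    ; symmetric = λ i j → does-⇔ (mk⇔ (~-sym _ _) (~-sym _ _)) (decode i ~? decode j) (decode j ~? decode i)
    ; loopless  = λ i → dec-false (decode i ~? decode i) (~-irrefl _)
    }

  Adj⇒~ : ∀ {i j} → Adj G i j → decode i ~ decode j
  Adj⇒~ {i} {j} eq with yes i~j ← decode i ~? decode j = i~j

  ~⇒Adj : ∀ {x y} → x ~ y → Adj G (encode x) (encode y)
  ~⇒Adj {x} {y} x~y = dec-true (decode (encode x) ~? decode (encode y))
    (subst (_~ decode (encode y)) (≡.sym (decode∘encode x)) (subst (x ~_) (≡.sym (decode∘encode y)) x~y))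

  record Neighbourhood (k : ℕ) (x : V) : Set where
    field
      neighbour : Fin k → V
      injective : ∀ {i j} → neighbour i ≡ neighbour j → i ≡ j
      adjacent  : ∀ i → x ~ neighbour i
      complete  : ∀ {y} → x ~ y → ∃[ i ] neighbour i ≡ y

  regular : ∀ {k} → (∀ x → Neighbourhood k x) → IsRegular G k
  regular neighbourhood v = card-enumerated (tabulate (Graph.adj G v)) (encode ∘ neighbour)
    (λ eq → injective (encode-injective eq))
    (λ i → ≡.trans (lookup∘tabulate (Graph.adj G v) (encode (neighbour i)))
      (dec-true (decode v ~? decode (encode (neighbour i)))
        (subst (decode v ~_) (≡.sym (decode∘encode _)) (adjacent i))))
    (λ w e → let i , eq = complete (Adj⇒~ (≡.trans (≡.sym (lookup∘tabulate (Graph.adj G v) w)) e))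
             in i , ≡.trans (cong encode eq) (Inverse.inverseʳ iso ≡.refl))
    where open Neighbourhood (neighbourhood (decode v))

-- Functions are searched through their codes in `Fin (n ^ m)`. Decoding gives back a function only
-- up to pointwise equality, hence the condition `resp`.
any-function? : ∀ {m n} {P : (Fin m → Fin n) → Set} → (∀ {f g} → f ≗ g → P f → P g) →
                Decidable P → Dec (∃[ f ] P f)
any-function? {m} {n} {P} resp P? =
  map′ (λ (c , Pc) → finToFun c , Pc)
       (λ (f , Pf) → funToFin f , resp (≡.sym ∘ Fin.finToFun-funToFin f) Pf)
       (Fin.any? (λ c → P? (finToFun {n} {m} c)))

least : ∀ {P : ℕ → Set} → Decidable P → ∀ {n} → P n → ∃[ l ] (IsLeast P l × l ≤ n)
least {P} P? {n} Pn with P? 0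
... | yes P0 = 0 , (P0 , λ _ _ → z≤n) , z≤n
least {P} P? {zero}  P0 | no ¬P0 = contradiction P0 ¬P0
least {P} P? {suc n} Pn | no ¬P0 with least (P? ∘ suc) {n} Pn
... | l , (Pl , minimal) , l≤n = suc l , (Pl , minimal′) , s≤s l≤n
  where
  minimal′ : ∀ m → P m → suc l ≤ m
  minimal′ zero    P0 = contradiction P0 ¬P0
  minimal′ (suc m) Pm = s≤s (minimal m Pm)

module _ {n} {G H : Graph n} (same : ∀ u v → Graph.adj G u v ≡ Graph.adj H u v) where

  degree-cong : ∀ v → degree G v ≡ degree H v
  degree-cong v = cong ∣_∣ (tabulate-cong (same v))

  cycle-cong : ∀ {l} → Cycle G l → Cycle H l
  cycle-cong (cycle v 2≤m inj step close) =
    cycle v 2≤m inj (λ i → ≡.trans (≡.sym (same _ _)) (step i)) (≡.trans (≡.sym (same _ _)) close)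

graph-cong : ∀ {n} {G H : Graph n} → (∀ u v → Graph.adj G u v ≡ Graph.adj H u v) →
             ∀ {k g} → Is[ k , g ]-graph G → Is[ k , g ]-graph H
graph-cong {G = G} {H} same is = record
  { regular = λ v → ≡.trans (≡.sym (degree-cong {G = G} {H} same v)) (regular v)
  ; girth   = cycle-cong {G = G} {H} same (proj₁ girth)
            , λ m c → proj₂ girth m (cycle-cong {G = H} {G} (λ u v → ≡.sym (same u v)) c)
  }
  where open Is[_,_]-graph is

module _ {n} (G : Graph n) where
  open Graph G using (adj)

  cycle? : Decidable (Cycle G)
  cycle? zero    = no λ ()
  cycle? (suc m) = map′
    (λ (2≤m , v , inj , step , close) → cycle v 2≤m (λ {i} {j} → inj i j) step close)
    (λ { (cycle v 2≤m inj step close) → 2≤m , v , (λ i j → inj) , step , close })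
    (2 ℕ.≤? m ×-dec any-function? resp λ v →
      Fin.all? (λ i → Fin.all? λ j → (v i Fin.≟ v j) →-dec (i Fin.≟ j))
      ×-dec Fin.all? (λ i → adj (v (inject₁ i)) (v (suc i)) Bool.≟ true)
      ×-dec (adj (v (fromℕ m)) (v zero) Bool.≟ true))
    where
    Closed : (Fin (suc m) → Fin n) → Set
    Closed v = (∀ i j → v i ≡ v j → i ≡ j)
             × (∀ i → Adj G (v (inject₁ i)) (v (suc i)))
             × Adj G (v (fromℕ m)) (v zero)
    resp : ∀ {f g} → f ≗ g → Closed f → Closed g
    resp f≗g (inj , step , close) =
      (λ i j eq → inj i j (≡.trans (f≗g i) (≡.trans eq (≡.sym (f≗g j)))))
      , (λ i → subst (λ x → Adj G x _) (f≗g _) (subst (Adj G _) (f≗g _) (step i)))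
      , subst (λ x → Adj G x _) (f≗g _) (subst (Adj G _) (f≗g _) close)

  -- Minimality concerns only the finitely many lengths below g.
  girth? : ∀ g → Dec (HasGirth G g)
  girth? g = cycle? g ×-dec map′
    (λ none m c → ℕ.≮⇒≥ λ m<g → none (Fin.fromℕ< m<g) (subst (Cycle G) (≡.sym (Fin.toℕ-fromℕ< m<g)) c))
    (λ least i c → ℕ.<⇒≱ (Fin.toℕ<n i) (least _ c))
    (Fin.all? λ (i : Fin g) → ¬? (cycle? (Fin.toℕ i)))

  is-graph? : ∀ k g → Dec (Is[ k , g ]-graph G)
  is-graph? k g = map′
    (λ (regular , girth) → record { regular = regular ; girth = girth })
    (λ is → Is[_,_]-graph.regular is , Is[_,_]-graph.girth is)
    (Fin.all? (λ v → degree G v ℕ.≟ k) ×-dec girth? g)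

exists-graph? : ∀ k g n → Dec (∃[ G ] Is[ k , g ]-graph {n} G)
exists-graph? k g n = map′
  (λ (f , symmetric , loopless , is) → graph f symmetric loopless , is)
  (λ (G , is) → code G , code-good G is)
  (any-function? {P = Good} resp good?)
  where
  open Inverse Fin.2↔Bool renaming (to to bit; from to unbit)
  adjacency : (Fin (n ℕ.* n) → Fin 2) → Fin n → Fin n → Bool
  adjacency f u v = bit (f (combine u v))

  Symmetric : (Fin (n ℕ.* n) → Fin 2) → Set
  Symmetric f = ∀ u v → adjacency f u v ≡ adjacency f v u
  Loopless : (Fin (n ℕ.* n) → Fin 2) → Set
  Loopless f = ∀ v → adjacency f v v ≡ false

  graph : ∀ f → Symmetric f → Loopless f → Graph n
  graph f symmetric loopless =
    record { adj = adjacency f ; symmetric = symmetric ; loopless = loopless }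

  Good : (Fin (n ℕ.* n) → Fin 2) → Set
  Good f = ∃[ s ] ∃[ l ] Is[ k , g ]-graph (graph f s l)

  resp : ∀ {f h} → f ≗ h → Good f → Good h
  resp {f} {h} f≗h (s , l , is) = s′ , l′ , graph-cong {G = graph f s l} {graph h s′ l′} same is
    where
    same : ∀ u v → adjacency f u v ≡ adjacency h u v
    same u v = cong bit (f≗h (combine u v))
    s′ : Symmetric h
    s′ u v = ≡.trans (≡.sym (same u v)) (≡.trans (s u v) (same v u))
    l′ : Loopless h
    l′ v = ≡.trans (≡.sym (same v v)) (l v)

  good? : Decidable Good
  good? f with Fin.all? (λ u → Fin.all? λ v → adjacency f u v Bool.≟ adjacency f v u)
             | Fin.all? (λ v → adjacency f v v Bool.≟ false)
  ... | no ¬s | _     = no λ (s , _) → ¬s s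
  ... | yes s | no ¬l = no λ (_ , l , _) → ¬l l
  ... | yes s | yes l = map′ (λ is → s , l , is)
    -- The graph property depends on the adjacency alone, so the given proofs of symmetry and
    -- looplessness may be exchanged for those just computed.
    (λ (s′ , l′ , is) → graph-cong {G = graph f s′ l′} {graph f s l} (λ _ _ → ≡.refl) is)
    (is-graph? (graph f s l) k g)

  code : Graph n → Fin (n ℕ.* n) → Fin 2
  code G = unbit ∘ uncurry (Graph.adj G) ∘ remQuot {n} n

  code-adj : ∀ G u v → Graph.adj G u v ≡ adjacency (code G) u v
  code-adj G u v = ≡.sym (≡.trans (cong bit (cong (unbit ∘ uncurry (Graph.adj G)) (Fin.remQuot-combine u v)))
                              (Inverse.inverseˡ Fin.2↔Bool ≡.refl))

  code-good : ∀ G → Is[ k , g ]-graph G → Good (code G)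
  code-good G is = s , l , graph-cong {G = G} {graph (code G) s l} (code-adj G) is
    where
    s : Symmetric (code G)
    s u v = ≡.trans (≡.sym (code-adj G u v)) (≡.trans (Graph.symmetric G u v) (code-adj G v u))
    l : Loopless (code G)
    l v = ≡.trans (≡.sym (code-adj G v v)) (Graph.loopless G v)

min-order : ∀ k g {n} {G : Graph n} → Is[ k , g ]-graph G → ∃[ l ] (IsMinOrder k g l × l ≤ n)
min-order k g is = least (exists-graph? k g) (_ , is)

-- The graph

module Rearrangement {n} (F : FiniteField n) where
  open FiniteField F
  open CommutativeRing ring hiding (zero; ring)

  Bijective : (Fin n → Carrier) → Set
  Bijective e = (∀ {i j} → e i ≈ e j → i ≡ j) × (∀ x → ∃[ i ] e i ≈ x)

  transpose-target : ∀ (i j : Fin n) → transpose i j i ≡ j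
  transpose-target i j with i Fin.≟ i
  ... | yes _   = ≡.refl
  ... | no  i≢i = contradiction ≡.refl i≢i

  transpose-other : ∀ (i j l : Fin n) → l ≢ i → l ≢ j → transpose i j l ≡ l
  transpose-other i j l l≢i l≢j with l Fin.≟ i
  ... | yes l≡i = contradiction l≡i l≢i
  ... | no  _ with l Fin.≟ j
  ...   | yes l≡j = contradiction l≡j l≢j
  ...   | no  _   = ≡.refl

  -- Precomposition with a transposition brings `x` to position `i` and moves nothing else but the
  -- old value at `i`.
  place : ∀ e → Bijective e → ∀ i x →
          ∃[ e′ ] (Bijective e′ × e′ i ≈ x × (∀ j → j ≢ i → ¬ e j ≈ x → e′ j ≈ e j))
  place e (injective , surjective) i x with surjective x
  ... | l , el≈x = e ∘ transpose i l
    , ( (λ {j} {j′} eq → ≡.trans (≡.sym (transpose-inverse l i))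
            (≡.trans (cong (transpose l i) (injective eq)) (transpose-inverse l i)))
      , (λ y → let j , ej≈y = surjective y in
            transpose l i j , trans (reflexive (cong e (transpose-inverse i l))) ej≈y))
    , trans (reflexive (cong e (transpose-target i l))) el≈x
    , λ j j≢i ej≉x → reflexive (cong e (transpose-other i l j j≢i λ { ≡.refl → ej≉x el≈x }))

-- The points 0, 1 and −1 (which is 1 in characteristic two) come first.
record Coordinates {r} (F : FiniteField (3 ℕ.+ r)) : Set where
  open FiniteField F
  open CommutativeRing ring hiding (zero; ring)
  field
    ⟦_⟧        : Fin (3 ℕ.+ r) → Carrier
    injective  : ∀ {i j} → ⟦ i ⟧ ≈ ⟦ j ⟧ → i ≡ j
    surjective : ∀ x → ∃[ i ] ⟦ i ⟧ ≈ x
    ⟦0⟧        : ⟦ 0F ⟧ ≈ 0#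
    ⟦1⟧        : ⟦ 1F ⟧ ≈ 1#
    ⟦2⟧        : ⟦ 2F ⟧ ≈ - 1# ⊎ 1# ≈ - 1#

-- Successive placements of 0, 1 and -1 do not disturb each other, as these are distinct; if 1 = -1
-- the third is omitted.
coordinates : ∀ {r} (F : FiniteField (3 ℕ.+ r)) → Coordinates F
coordinates F = place₂ (1# ≟ - 1#)
  where
  open FiniteField F
  open CommutativeRing ring hiding (zero; ring)
  open Rearrangement F
  open import Algebra.Properties.Group +-group using (⁻¹-injective) renaming (ε⁻¹≈ε to -0≈0)
  0≉1 : ¬ 0# ≈ 1#
  0≉1 = 1≉0 ∘ sym
  0≉-1 : ¬ 0# ≈ - 1#
  0≉-1 0≈-1 = 0≉1 (⁻¹-injective (trans -0≈0 0≈-1))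
  place₂ : Dec (1# ≈ - 1#) → Coordinates F
  place₂ 1≟-1 with place element (element-injective , element-surjective) 0F 0#
  ... | e₀ , bij₀ , e₀0 , _ with place e₀ bij₀ 1F 1#
  ...   | e₁ , bij₁ , e₁1 , same₁ with trans (same₁ 0F (λ ()) (0≉1 ∘ trans (sym e₀0))) e₀0 | 1≟-1
  ...     | e₁0 | yes 1≈-1 = record
    { ⟦_⟧ = e₁ ; injective = proj₁ bij₁ ; surjective = proj₂ bij₁
    ; ⟦0⟧ = e₁0 ; ⟦1⟧ = e₁1 ; ⟦2⟧ = inj₂ 1≈-1 }
  ...     | e₁0 | no  1≉-1 with place e₁ bij₁ 2F (- 1#)
  ...       | e₂ , bij₂ , e₂2 , same₂ = record
    { ⟦_⟧ = e₂ ; injective = proj₁ bij₂ ; surjective = proj₂ bij₂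
    ; ⟦0⟧ = trans (same₂ 0F (λ ()) (0≉-1 ∘ trans (sym e₁0))) e₁0
    ; ⟦1⟧ = trans (same₂ 1F (λ ()) (1≉-1 ∘ trans (sym e₁1))) e₁1
    ; ⟦2⟧ = inj₁ e₂2 }

swap-pairs : ∀ m → Fin (m ℕ.* 2) → Fin (m ℕ.* 2)
swap-pairs (suc m) zero          = suc zero
swap-pairs (suc m) (suc zero)    = zero
swap-pairs (suc m) (suc (suc i)) = suc (suc (swap-pairs m i))

swap-pairs-involutive : ∀ m i → swap-pairs m (swap-pairs m i) ≡ i
swap-pairs-involutive (suc m) zero          = ≡.refl
swap-pairs-involutive (suc m) (suc zero)    = ≡.refl
swap-pairs-involutive (suc m) (suc (suc i)) = cong (λ j → Fin.suc (Fin.suc j)) (swap-pairs-involutive m i)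

swap-pairs-no-fixpoint : ∀ m i → i ≢ swap-pairs m i
swap-pairs-no-fixpoint (suc m) (suc (suc i)) eq =
  swap-pairs-no-fixpoint m i (Fin.suc-injective (Fin.suc-injective eq))

-- The incidence graph with matched lines, and its regularity

module Construction {r} {F : FiniteField (3 ℕ.+ r)} (C : Coordinates F)
                    (m : ℕ) (k≤q : (2 ℕ.+ m) ℕ.* 2 ≤ 3 ℕ.+ r) where
  open FiniteField F using (ring; _≟_; cancel)
  open CommutativeRing ring hiding (zero; ring)
  open Coordinates C
  open DifferenceSolver ring using (solve; _:=_; _:+_; _:*_; _:-_)
  open import Algebra.Properties.Group +-group
    using (x∙y⁻¹≈ε⇒x≈y; x≈y⇒x∙y⁻¹≈ε; ∙-cancelˡ)
  open import Relation.Binary.Reasoning.Setoid setoid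

  k q : ℕ
  k = (2 ℕ.+ m) ℕ.* 2
  q = 3 ℕ.+ r

  σ : Fin k → Fin k
  σ = swap-pairs (2 ℕ.+ m)

  -- The sets A and B are both taken to be the first k coordinates. As k is at least 4, they contain
  -- 0, 1 and -1.
  slope : Fin k → Carrier
  slope i = ⟦ inject≤ i k≤q ⟧

  slope-injective : ∀ {i j} → slope i ≈ slope j → i ≡ j
  slope-injective eq = Fin.inject≤-injective _ _ _ _ (injective eq)

  -- A point (x, y, z) is stored as the index of (x, y) among the pairs other than
  -- (0, 0), together with z.
  pairs : ℕ
  pairs = ℕ.pred (k ℕ.* q)

  Vertex : Set
  Vertex = (Fin pairs × Fin q) ⊎ (Fin k × Fin q × Fin q)

  pattern point c z  = inj₁ (c , z)
  pattern line j u w = inj₂ (j , u , w)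

  point-cong : ∀ {c c′ z z′} → c ≡ c′ → z ≡ z′ → _≡_ {A = Vertex} (point c z) (point c′ z′)
  point-cong ≡.refl ≡.refl = ≡.refl

  line-cong : ∀ {j j′ u u′ w w′} → j ≡ j′ → u ≡ u′ → w ≡ w′ →
              _≡_ {A = Vertex} (line j u w) (line j′ u′ w′)
  line-cong ≡.refl ≡.refl ≡.refl = ≡.refl

  order : ℕ
  order = pairs ℕ.* q ℕ.+ k ℕ.* (q ℕ.* q)

  vertices : Fin order ↔ Vertex
  vertices = (Fin.*↔× ⊎-↔ ((↔-id _ ×-↔ Fin.*↔×) ↔-∘ Fin.*↔×)) ↔-∘ Fin.+↔⊎

  -- The shift by `suc` skips index 0, which is the code of (0, 0).
  col : Fin pairs → Fin k
  col c = proj₁ (remQuot {k} q (suc c))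

  row : Fin pairs → Fin q
  row c = proj₂ (remQuot {k} q (suc c))

  combine-col-row : ∀ c → combine (col c) (row c) ≡ suc c
  combine-col-row c = Fin.combine-remQuot {k} q (suc c)

  col-row-injective : ∀ {c c′} → col c ≡ col c′ → row c ≡ row c′ → c ≡ c′
  col-row-injective {c} {c′} eq₁ eq₂ = Fin.suc-injective
    (≡.trans (≡.sym (combine-col-row c)) (≡.trans (cong₂ combine eq₁ eq₂) (combine-col-row c′)))

  not-origin : ∀ c → ¬ (col c ≡ zero × row c ≡ zero)
  not-origin c (eq₁ , eq₂) with ≡.trans (≡.sym (combine-col-row c)) (cong₂ combine eq₁ eq₂)
  ... | ()

  locate : ∀ x y → ¬ (x ≡ zero × y ≡ zero) → ∃[ c ] (col c ≡ x × row c ≡ y)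
  locate x y nonzero = helper (combine x y) (Fin.remQuot-combine x y)
    where
    helper : ∀ i → remQuot {k} q i ≡ (x , y) → ∃[ c ] (col c ≡ x × row c ≡ y)
    helper zero    eq = contradiction (≡.sym (cong proj₁ eq) , ≡.sym (cong proj₂ eq)) nonzero
    helper (suc c) eq = c , cong proj₁ eq , cong proj₂ eq

  a : Fin pairs → Carrier
  a c = slope (col c)

  record Incident (c : Fin pairs) (z : Fin q) (j : Fin k) (u w : Fin q) : Set where
    constructor incident
    field
      y-equation : ⟦ row c ⟧ + ⟦ u ⟧ ≈ a c * slope j
      z-equation : ⟦ z ⟧ + ⟦ w ⟧ ≈ a c * ⟦ u ⟧

  infix 4 _~_ _~?_

  -- The last clause is the added matching: the lines [s, 0, w] with fixed w are the former
  -- neighbours of the removed point (0, 0, -w).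
  _~_ : Vertex → Vertex → Set
  point _ _  ~ point _ _     = ⊥
  point c z  ~ line j u w    = Incident c z j u w
  line j u w ~ point c z     = Incident c z j u w
  line j u w ~ line j′ u′ w′ = (u ≡ zero × u′ ≡ zero) × w ≡ w′ × j′ ≡ σ j

  incident? : ∀ c z j u w → Dec (Incident c z j u w)
  incident? c z j u w = map′ (λ (eq₁ , eq₂) → incident eq₁ eq₂) (λ (incident eq₁ eq₂) → eq₁ , eq₂)
    (⟦ row c ⟧ + ⟦ u ⟧ ≟ a c * slope j ×-dec ⟦ z ⟧ + ⟦ w ⟧ ≟ a c * ⟦ u ⟧)

  _~?_ : Decidable₂ _~_
  point _ _  ~? point _ _     = no λ ()
  point c z  ~? line j u w    = incident? c z j u w
  line j u w ~? point c z     = incident? c z j u w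
  line j u w ~? line j′ u′ w′ =
    ((u Fin.≟ zero) ×-dec (u′ Fin.≟ zero)) ×-dec (w Fin.≟ w′) ×-dec (j′ Fin.≟ σ j)

  ~-sym : ∀ x y → x ~ y → y ~ x
  ~-sym (point _ _)  (line _ _ _) inc = inc
  ~-sym (line _ _ _) (point _ _)  inc = inc
  ~-sym (line j _ _) (line _ _ _) ((u≡0 , u′≡0) , w≡w′ , ≡.refl) =
    (u′≡0 , u≡0) , ≡.sym w≡w′ , ≡.sym (swap-pairs-involutive (2 ℕ.+ m) j)

  ~-irrefl : ∀ x → ¬ x ~ x
  ~-irrefl (line j _ _) (_ , _ , j≡σj) = swap-pairs-no-fixpoint (2 ℕ.+ m) j j≡σj

  open FromRelation vertices _~?_ ~-sym ~-irrefl public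

  index : Carrier → Fin q
  index x = proj₁ (surjective x)

  ⟦index⟧ : ∀ x → ⟦ index x ⟧ ≈ x
  ⟦index⟧ x = proj₂ (surjective x)

  index-unique : ∀ {i x} → ⟦ i ⟧ ≈ x → index x ≡ i
  index-unique eq = injective (trans (⟦index⟧ _) (sym eq))

  x≈z-y : ∀ {x y z} → y + x ≈ z → x ≈ z - y
  x≈z-y {x} {y} {z} eq = trans (solve 2 (λ x y → x := (y :+ x) :- y) refl x y) (+-congʳ eq)

  y+[z-y]≈z : ∀ y z → y + (z - y) ≈ z
  y+[z-y]≈z = solve 2 (λ y z → y :+ (z :- y) := z) refl

  [z-y]+y≈z : ∀ y z → (z - y) + y ≈ z
  [z-y]+y≈z = solve 2 (λ y z → (z :- y) :+ y := z) refl

  x≈z-y′ : ∀ {x y z} → x + y ≈ z → x ≈ z - y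
  x≈z-y′ eq = x≈z-y (trans (+-comm _ _) eq)

  slope-0 : slope zero ≈ 0#
  slope-0 = ⟦0⟧

  point-neighbourhood : ∀ c z → Neighbourhood k (point c z)
  point-neighbourhood c z = record
    { neighbour = λ j → line j (u j) (w j)
    ; injective = λ { ≡.refl → ≡.refl }
    ; adjacent  = λ j → incident (trans (+-congˡ (⟦index⟧ _)) (y+[z-y]≈z _ _))
                                 (trans (+-congˡ (⟦index⟧ _)) (y+[z-y]≈z _ _))
    ; complete  = complete
    }
    where
    u w : Fin k → Fin q
    u j = index (a c * slope j - ⟦ row c ⟧)
    w j = index (a c * ⟦ u j ⟧ - ⟦ z ⟧)
    complete : ∀ {y} → point c z ~ y → ∃[ j ] line j (u j) (w j) ≡ y
    complete {line j u′ w′} (incident eq₁ eq₂) = j , line-cong ≡.refl u≡ (index-unique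
      (x≈z-y (trans eq₂ (*-congˡ (reflexive (cong ⟦_⟧ (≡.sym u≡)))))))
      where
      u≡ : u j ≡ u′
      u≡ = index-unique (x≈z-y eq₁)

  -- A line has one point for each first coordinate x. If u = 0, the point with x = 0 is a removed
  -- one, and the matched line takes its place.
  module LineNeighbours (j : Fin k) (u w : Fin q) where
    yᵢ zᵢ : Fin k → Fin q
    yᵢ i = index (slope i * slope j - ⟦ u ⟧)
    zᵢ i = index (slope i * ⟦ u ⟧ - ⟦ w ⟧)

    Vertical : Fin k → Set
    Vertical i = i ≡ zero × u ≡ zero

    located : ∀ i → ¬ Vertical i → ∃[ c ] (col c ≡ i × row c ≡ yᵢ i)
    located i nv = locate i (yᵢ i) λ { (≡.refl , y≡0) → nv (≡.refl , injective (begin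
      ⟦ u ⟧                       ≈⟨ solve 3 (λ s j u → u := s :* j :- (s :* j :- u)) refl (slope zero) (slope j) ⟦ u ⟧ ⟩
      slope zero * slope j - (slope zero * slope j - ⟦ u ⟧)
        ≈⟨ +-cong (trans (*-congʳ slope-0) (zeroˡ _)) (-‿cong (trans (sym (⟦index⟧ _)) (trans (reflexive (cong ⟦_⟧ y≡0)) ⟦0⟧))) ⟩
      0# - 0#                     ≈⟨ -‿inverseʳ 0# ⟩
      0#                          ≈⟨ ⟦0⟧ ⟨
      ⟦ zero ⟧                    ∎)) }

    vertical? : ∀ i → Dec (Vertical i)
    vertical? i = (i Fin.≟ zero) ×-dec (u Fin.≟ zero)

    choose : ∀ i → Dec (Vertical i) → Vertex
    choose i (yes _)  = line (σ j) zero w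
    choose i (no  nv) = point (proj₁ (located i nv)) (zᵢ i)

    choose-injective : ∀ {i i′} d d′ → choose i d ≡ choose i′ d′ → i ≡ i′
    choose-injective (yes (i≡0 , _)) (yes (i′≡0 , _)) _ = ≡.trans i≡0 (≡.sym i′≡0)
    choose-injective (no nv) (no nv′) eq =
      ≡.trans (≡.sym (proj₁ (proj₂ (located _ nv))))
        (≡.trans (cong col (,-injectiveˡ (inj₁-injective eq))) (proj₁ (proj₂ (located _ nv′))))

    choose-adjacent : ∀ i d → line j u w ~ choose i d
    choose-adjacent i (yes (_ , u≡0)) = (u≡0 , ≡.refl) , ≡.refl , ≡.refl
    choose-adjacent i (no nv) with located i nv
    ... | c , ≡.refl , row≡ = incident
      (trans (+-congʳ (trans (reflexive (cong ⟦_⟧ row≡)) (⟦index⟧ _))) ([z-y]+y≈z _ _))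
      (trans (+-congʳ (⟦index⟧ _)) ([z-y]+y≈z _ _))

    choose-complete : ∀ {y} → line j u w ~ y → ∃[ i ] choose i (vertical? i) ≡ y
    choose-complete {line _ _ _} ((≡.refl , ≡.refl) , ≡.refl , ≡.refl) = zero , ≡.refl
    choose-complete {point c z} (incident eq₁ eq₂) = col c , helper (vertical? (col c))
      where
      row≡ : row c ≡ yᵢ (col c)
      row≡ = ≡.sym (index-unique (x≈z-y′ eq₁))
      helper : ∀ d → choose (col c) d ≡ point c z
      helper (yes (col≡0 , u≡0)) = contradiction (col≡0 , injective (begin
        ⟦ row c ⟧            ≈⟨ x≈z-y′ eq₁ ⟩
        a c * slope j - ⟦ u ⟧ ≈⟨ +-cong (*-congʳ (reflexive (cong slope col≡0))) (-‿cong (reflexive (cong ⟦_⟧ u≡0))) ⟩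
        slope zero * slope j - ⟦ zero ⟧ ≈⟨ +-cong (trans (*-congʳ slope-0) (zeroˡ _)) (-‿cong ⟦0⟧) ⟩
        0# - 0#              ≈⟨ -‿inverseʳ 0# ⟩
        0#                   ≈⟨ ⟦0⟧ ⟨
        ⟦ zero ⟧             ∎)) (not-origin c)
      helper (no nv) with located (col c) nv
      ... | c′ , col′≡ , row′≡ = point-cong
        (col-row-injective col′≡ (≡.trans row′≡ (≡.sym row≡)))
        (index-unique (x≈z-y′ eq₂))

    neighbourhood : Neighbourhood k (line j u w)
    neighbourhood = record
      { neighbour = λ i → choose i (vertical? i)
      ; injective = λ {i} {i′} → choose-injective (vertical? i) (vertical? i′)
      ; adjacent  = λ i → choose-adjacent i (vertical? i)
      ; complete  = choose-complete
      }

  neighbourhood : ∀ v → Neighbourhood k v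
  neighbourhood (point c z)  = point-neighbourhood c z
  neighbourhood (line j u w) = LineNeighbours.neighbourhood j u w

  -- Absence of cycles shorter than seven

  infix 4 _≢ᵥ_
  _≢ᵥ_ : Vertex → Vertex → Set
  x ≢ᵥ y = x ≢ y

  -- Short cycles are excluded as closed walks without backtracking, presented by their consecutive
  -- triples.
  record Turn (x y z : Vertex) : Set where
    constructor turn
    field
      enter   : x ~ y
      leave   : y ~ z
      no-back : x ≢ᵥ z

  x-y≉0 : ∀ {x y} → ¬ x ≈ y → ¬ x - y ≈ 0#
  x-y≉0 x≉y eq = x≉y (x∙y⁻¹≈ε⇒x≈y _ _ eq)

  +-differences : ∀ {y u u′ s s′} → y + u ≈ s → y + u′ ≈ s′ → u - u′ ≈ s - s′
  +-differences {y} {u} {u′} eq eq′ =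
    trans (solve 3 (λ y u v → u :- v := (y :+ u) :- (y :+ v)) refl y u u′) (+-cong eq (-‿cong eq′))

  -- Subtracting the equations of two lines through one point eliminates y here, and z in
  -- `w-differences`.
  u-differences : ∀ {c z j u w j′ u′ w′} → Incident c z j u w → Incident c z j′ u′ w′ →
                  ⟦ u ⟧ - ⟦ u′ ⟧ ≈ a c * (slope j - slope j′)
  u-differences {c} {j = j} {j′ = j′} (incident eq _) (incident eq′ _) = trans (+-differences eq eq′)
    (solve 3 (λ a s t → a :* s :- a :* t := a :* (s :- t)) refl (a c) (slope j) (slope j′))

  w-differences : ∀ {c z j u w j′ u′ w′} → Incident c z j u w → Incident c z j′ u′ w′ →
                  ⟦ w ⟧ - ⟦ w′ ⟧ ≈ a c * (⟦ u ⟧ - ⟦ u′ ⟧)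
  w-differences {c} {u = u} {u′ = u′} (incident _ eq) (incident _ eq′) = trans (+-differences eq eq′)
    (solve 3 (λ a s t → a :* s :- a :* t := a :* (s :- t)) refl (a c) ⟦ u ⟧ ⟦ u′ ⟧)

  -- A point and a slope determine the line.
  distinct-slopes : ∀ {c z j u w j′ u′ w′} → Incident c z j u w → Incident c z j′ u′ w′ →
                    line j u w ≢ᵥ line j′ u′ w′ → ¬ slope j - slope j′ ≈ 0#
  distinct-slopes {c} {z} {j} {u} {w} {j′} {u′} {w′} (incident eq₁ eq₂) (incident eq₁′ eq₂′) L≢L′ =
    x-y≉0 λ eq → helper (slope-injective eq)
    where
    helper : j ≢ j′
    helper ≡.refl with injective (∙-cancelˡ ⟦ row c ⟧ _ _ (trans eq₁ (sym eq₁′)))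
    ... | ≡.refl with injective (∙-cancelˡ ⟦ z ⟧ _ _ (trans eq₂ (sym eq₂′)))
    ...   | ≡.refl = L≢L′ ≡.refl

  -- A line and a first coordinate determine the point.
  distinct-a : ∀ {c z c′ z′ j u w} → Incident c z j u w → Incident c′ z′ j u w →
               point c z ≢ᵥ point c′ z′ → ¬ a c - a c′ ≈ 0#
  distinct-a {c} {z} {c′} {z′} (incident eq₁ eq₂) (incident eq₁′ eq₂′) P≢P′ = x-y≉0 λ ac≈ac′ →
    P≢P′ (point-cong
      (col-row-injective (slope-injective ac≈ac′)
        (injective (trans (x≈z-y′ eq₁) (trans (+-congʳ (*-congʳ ac≈ac′)) (sym (x≈z-y′ eq₁′))))))
      (injective (trans (x≈z-y′ eq₂) (trans (+-congʳ (*-congʳ ac≈ac′)) (sym (x≈z-y′ eq₂′))))))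

  -- The removed points are the only ones joining two lines with u = 0.
  no-flat-turn : ∀ {c z j w j′ w′} → Incident c z j zero w → Incident c z j′ zero w′ →
                 line j zero w ≢ᵥ line j′ zero w′ → ⊥
  no-flat-turn {c} {j = j} {j′ = j′} inc inc′ L≢L′ =
    not-origin c (slope-injective (trans a≈0 (sym slope-0)) , injective (begin
      ⟦ row c ⟧                 ≈⟨ x≈z-y′ (Incident.y-equation inc) ⟩
      a c * slope j - ⟦ zero ⟧  ≈⟨ +-cong (trans (*-congʳ a≈0) (zeroˡ _)) (-‿cong ⟦0⟧) ⟩
      0# - 0#                   ≈⟨ -‿inverseʳ 0# ⟩
      0#                        ≈⟨ ⟦0⟧ ⟨
      ⟦ zero ⟧                  ∎))
    where
    a≈0 : a c ≈ 0#
    a≈0 = cancel (begin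
      (slope j - slope j′) * a c ≈⟨ *-comm _ _ ⟩
      a c * (slope j - slope j′) ≈⟨ u-differences inc inc′ ⟨
      ⟦ zero ⟧ - ⟦ zero ⟧        ≈⟨ -‿inverseʳ _ ⟩
      0#                         ∎) (distinct-slopes inc inc′ L≢L′)

  same-product : ∀ {x y z} → x * z ≈ y * z → ¬ x - y ≈ 0# → z ≈ 0#
  same-product {x} {y} {z} eq x≉y = cancel
    (trans (solve 3 (λ x y z → (x :- y) :* z := x :* z :- y :* z) refl x y z) (x≈y⇒x∙y⁻¹≈ε eq)) x≉y

  -- Both points express u - u′ as a multiple of the same slope difference, but with different
  -- factors x.
  no-quadrangle : ∀ {c z c′ z′ j u w j′ u′ w′} →
    Incident c z j u w → Incident c z j′ u′ w′ → Incident c′ z′ j u w → Incident c′ z′ j′ u′ w′ →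
    point c z ≢ᵥ point c′ z′ → line j u w ≢ᵥ line j′ u′ w′ → ⊥
  no-quadrangle PL PL′ P′L P′L′ P≢P′ L≢L′ = distinct-slopes PL PL′ L≢L′
    (same-product (trans (sym (u-differences PL PL′)) (u-differences P′L P′L′)) (distinct-a PL P′L P≢P′))

  -- Both points express w₂ - w as a multiple of u₂ with different factors x. So u₂ = 0, and the
  -- first point joins two lines with u = 0.
  no-pentagon : ∀ {c z c′ z′ j₀ j₁ w j₂ u₂ w₂} →
    Incident c z j₁ zero w → Incident c z j₂ u₂ w₂ → Incident c′ z′ j₂ u₂ w₂ → Incident c′ z′ j₀ zero w →
    point c z ≢ᵥ point c′ z′ → line j₁ zero w ≢ᵥ line j₂ u₂ w₂ → ⊥
  no-pentagon {j₁ = j₁} {w = w} {j₂} {u₂} {w₂} PL₁ PL₂ P′L₂ P′L₀ P≢P′ L₁≢L₂ = flat u₂≡0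
    where
    u₂≡0 : u₂ ≡ zero
    u₂≡0 = injective (x∙y⁻¹≈ε⇒x≈y _ _ (same-product
      (trans (sym (w-differences PL₂ PL₁)) (w-differences P′L₂ P′L₀)) (distinct-a PL₂ P′L₂ P≢P′)))
    flat : ¬ u₂ ≡ zero
    flat ≡.refl = no-flat-turn PL₁ PL₂ L₁≢L₂

  -- The three equations are combined with the coefficients of -(t - a₁)(t - a₂), which vanishes at
  -- a₁ and a₂ and so eliminates `c` and `d`.
  vandermonde : ∀ a₀ a₁ a₂ {b c d} → (b + c) + d ≈ 0# → (a₀ * b + a₁ * c) + a₂ * d ≈ 0# →
                (a₀ * (a₀ * b) + a₁ * (a₁ * c)) + a₂ * (a₂ * d) ≈ 0# →
                (a₂ - a₀) * ((a₀ - a₁) * b) ≈ 0#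
  vandermonde a₀ a₁ a₂ {b} {c} {d} eq₀ eq₁ eq₂ = begin
    (a₂ - a₀) * ((a₀ - a₁) * b)
      ≈⟨ solve 6 (λ x y z b c d → (z :- x) :* ((x :- y) :* b)
           := (y :+ z) :* ((x :* b :+ y :* c) :+ z :* d)
              :- (((x :* (x :* b) :+ y :* (y :* c)) :+ z :* (z :* d)) :+ y :* z :* ((b :+ c) :+ d)))
           refl a₀ a₁ a₂ b c d ⟩
    (a₁ + a₂) * ((a₀ * b + a₁ * c) + a₂ * d)
      - (((a₀ * (a₀ * b) + a₁ * (a₁ * c)) + a₂ * (a₂ * d)) + a₁ * a₂ * ((b + c) + d))
      ≈⟨ +-cong (trans (*-congˡ eq₁) (zeroʳ _))
                (-‿cong (trans (+-cong eq₂ (trans (*-congˡ eq₀) (zeroʳ _))) (+-identityˡ 0#))) ⟩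
    0# - 0#
      ≈⟨ -‿inverseʳ 0# ⟩
    0# ∎

  -- Around the hexagon the differences of s, of u and of w each sum to zero. At each point they are
  -- the slope difference times 1, x and x², which gives a Vandermonde system forcing the first
  -- slope difference to vanish.
  no-hexagon : ∀ {c₀ z₀ c₁ z₁ c₂ z₂ j₀ u₀ w₀ j₁ u₁ w₁ j₂ u₂ w₂} →
    Incident c₀ z₀ j₀ u₀ w₀ → Incident c₀ z₀ j₁ u₁ w₁ →
    Incident c₁ z₁ j₁ u₁ w₁ → Incident c₁ z₁ j₂ u₂ w₂ →
    Incident c₂ z₂ j₂ u₂ w₂ → Incident c₂ z₂ j₀ u₀ w₀ →
    line j₀ u₀ w₀ ≢ᵥ line j₁ u₁ w₁ → point c₀ z₀ ≢ᵥ point c₁ z₁ → point c₂ z₂ ≢ᵥ point c₀ z₀ → ⊥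
  no-hexagon {c₀} {c₁ = c₁} {c₂ = c₂} {j₀ = j₀} {u₀} {w₀} {j₁} {u₁} {w₁} {j₂} {u₂} {w₂}
             P₀L₀ P₀L₁ P₁L₁ P₁L₂ P₂L₂ P₂L₀ L₀≢L₁ P₀≢P₁ P₂≢P₀ =
    distinct-slopes P₀L₀ P₀L₁ L₀≢L₁
      (cancel (cancel (vandermonde (a c₀) (a c₁) (a c₂) slopes us ws)
                      (distinct-a P₂L₀ P₀L₀ P₂≢P₀))
              (distinct-a P₀L₁ P₁L₁ P₀≢P₁))
    where
    telescope : ∀ x y z → ((x - y) + (y - z)) + (z - x) ≈ 0#
    telescope = solve 3 (λ x y z → ((x :- y) :+ (y :- z)) :+ (z :- x) := :0) refl
      where open DifferenceSolver ring using (:0)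
    slopes : ((slope j₀ - slope j₁) + (slope j₁ - slope j₂)) + (slope j₂ - slope j₀) ≈ 0#
    slopes = telescope _ _ _
    e₀ = u-differences P₀L₀ P₀L₁
    e₁ = u-differences P₁L₁ P₁L₂
    e₂ = u-differences P₂L₂ P₂L₀
    us = trans (sym (+-cong (+-cong e₀ e₁) e₂)) (telescope _ _ _)
    ws = trans (sym (+-cong (+-cong (trans (w-differences P₀L₀ P₀L₁) (*-congˡ e₀))
                                    (trans (w-differences P₁L₁ P₁L₂) (*-congˡ e₁)))
                            (trans (w-differences P₂L₂ P₂L₀) (*-congˡ e₂))))
               (telescope _ _ _)

  -- Matching edges are disjoint: `σ` is an involution.
  no-line-path : ∀ {j₀ u₀ w₀ j₁ u₁ w₁ j₂ u₂ w₂} →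
                 ¬ Turn (line j₀ u₀ w₀) (line j₁ u₁ w₁) (line j₂ u₂ w₂)
  no-line-path {j₀} (turn ((≡.refl , ≡.refl) , ≡.refl , ≡.refl) ((_ , ≡.refl) , ≡.refl , ≡.refl) L₀≢L₂) =
    L₀≢L₂ (line-cong (≡.sym (swap-pairs-involutive (2 ℕ.+ m) j₀)) ≡.refl ≡.refl)

  -- All neighbours of a point are lines, so the opposite edge is a matching edge and its ends are
  -- two lines with u = 0 through the point.
  triangle-at-point : ∀ {c z x y} → Turn (point c z) x y → Turn x y (point c z) → Turn y (point c z) x → ⊥
  triangle-at-point {x = line _ _ _} {line _ _ _}
    (turn PL ((≡.refl , ≡.refl) , _) _) _ (turn PL′ _ L′≢L) = no-flat-turn PL PL′ (L′≢L ∘ ≡.sym)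

  quadrangle-at-point : ∀ {c z x y t} → let P = point c z in
    Turn P x y → Turn x y t → Turn y t P → Turn t P x → ⊥
  quadrangle-at-point {x = line _ _ _} {point _ _} {line _ _ _}
    (turn PL P′L P≢P′) (turn _ P′L′ L≢L′) (turn _ PL′ _) _ = no-quadrangle PL PL′ P′L P′L′ P≢P′ L≢L′
  quadrangle-at-point {x = line _ _ _} {line _ _ _} {line _ _ _} _ t _ _ = no-line-path t

  -- Apart from three lines in a row there is exactly one matching edge, on one side of the cycle or
  -- the other.
  pentagon-at-point : ∀ {c z x y t s} → let P = point c z in
    Turn P x y → Turn x y t → Turn y t s → Turn t s P → Turn s P x → ⊥
  pentagon-at-point {x = line _ _ _} {line _ _ _} {line _ _ _} {line _ _ _} _ t _ _ _ = no-line-path t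
  pentagon-at-point {x = line _ _ _} {line _ _ _} {point _ _} {line _ _ _}
    _ (turn ((≡.refl , ≡.refl) , ≡.refl , _) _ _) (turn P′L₁ P′L₂ L₁≢L₂) (turn _ PL₂ P′≢P) (turn _ PL₀ _) =
    no-pentagon P′L₁ P′L₂ PL₂ PL₀ P′≢P L₁≢L₂
  pentagon-at-point {x = line _ _ _} {point _ _} {line _ _ _} {line _ _ _}
    (turn PL₂ P′L₂ P≢P′) _ (turn P′L₀ ((≡.refl , ≡.refl) , ≡.refl , _) _) (turn _ PL₁ _) (turn _ _ L₁≢L₂) =
    no-pentagon PL₁ PL₂ P′L₂ P′L₀ P≢P′ L₁≢L₂

  -- The number of matching edges is even. Two of them either meet or have a point between lines
  -- with u = 0; with none it is a hexagon of the incidence graph.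
  hexagon-at-point : ∀ {c z x y t s r} → let P = point c z in
    Turn P x y → Turn x y t → Turn y t s → Turn t s r → Turn s r P → Turn r P x → ⊥
  hexagon-at-point {x = line _ _ _} {line _ _ _} {line _ _ _} _ t _ _ _ _ = no-line-path t
  hexagon-at-point {x = line _ _ _} {line _ _ _} {point _ _} {line _ _ _} {line _ _ _}
    _ (turn ((_ , ≡.refl) , _) _ _) (turn PL PL′ L≢L′) (turn _ ((≡.refl , _) , _) _) _ _ = no-flat-turn PL PL′ L≢L′
  hexagon-at-point {x = line _ _ _} {point _ _} {line _ _ _} {line _ _ _} {line _ _ _} _ _ _ t _ _ =
    no-line-path t
  hexagon-at-point {x = line _ _ _} {point _ _} {line _ _ _} {point _ _} {line _ _ _}
    (turn P₀L₁ P₁L₁ P₀≢P₁) _ (turn P₁L₂ P₂L₂ _) _ (turn P₂L₀ P₀L₀ P₂≢P₀) (turn _ _ L₀≢L₁) =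
    no-hexagon P₀L₀ P₀L₁ P₁L₁ P₁L₂ P₂L₂ P₂L₀ L₀≢L₁ P₀≢P₁ P₂≢P₀

  -- A cycle has a point among any three consecutive vertices: rotate it to the front.
  no-triangle : ∀ {x y t} → Turn x y t → Turn y t x → Turn t x y → ⊥
  no-triangle {point _ _}                      t₀ t₁ t₂ = triangle-at-point t₀ t₁ t₂
  no-triangle {line _ _ _} {point _ _}         t₀ t₁ t₂ = triangle-at-point t₁ t₂ t₀
  no-triangle {line _ _ _} {line _ _ _} {point _ _} t₀ t₁ t₂ = triangle-at-point t₂ t₀ t₁
  no-triangle {line _ _ _} {line _ _ _} {line _ _ _} t₀ _ _ = no-line-path t₀

  no-4-cycle : ∀ {x y t s} → Turn x y t → Turn y t s → Turn t s x → Turn s x y → ⊥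
  no-4-cycle {point _ _}                      t₀ t₁ t₂ t₃ = quadrangle-at-point t₀ t₁ t₂ t₃
  no-4-cycle {line _ _ _} {point _ _}         t₀ t₁ t₂ t₃ = quadrangle-at-point t₁ t₂ t₃ t₀
  no-4-cycle {line _ _ _} {line _ _ _} {point _ _} t₀ t₁ t₂ t₃ = quadrangle-at-point t₂ t₃ t₀ t₁
  no-4-cycle {line _ _ _} {line _ _ _} {line _ _ _} t₀ _ _ _ = no-line-path t₀

  no-5-cycle : ∀ {x y t s r} → Turn x y t → Turn y t s → Turn t s r → Turn s r x → Turn r x y → ⊥
  no-5-cycle {point _ _}                      t₀ t₁ t₂ t₃ t₄ = pentagon-at-point t₀ t₁ t₂ t₃ t₄
  no-5-cycle {line _ _ _} {point _ _}         t₀ t₁ t₂ t₃ t₄ = pentagon-at-point t₁ t₂ t₃ t₄ t₀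
  no-5-cycle {line _ _ _} {line _ _ _} {point _ _} t₀ t₁ t₂ t₃ t₄ = pentagon-at-point t₂ t₃ t₄ t₀ t₁
  no-5-cycle {line _ _ _} {line _ _ _} {line _ _ _} t₀ _ _ _ _ = no-line-path t₀

  no-6-cycle : ∀ {x y t s r v} → Turn x y t → Turn y t s → Turn t s r → Turn s r v → Turn r v x → Turn v x y → ⊥
  no-6-cycle {point _ _}                      t₀ t₁ t₂ t₃ t₄ t₅ = hexagon-at-point t₀ t₁ t₂ t₃ t₄ t₅
  no-6-cycle {line _ _ _} {point _ _}         t₀ t₁ t₂ t₃ t₄ t₅ = hexagon-at-point t₁ t₂ t₃ t₄ t₅ t₀
  no-6-cycle {line _ _ _} {line _ _ _} {point _ _} t₀ t₁ t₂ t₃ t₄ t₅ = hexagon-at-point t₂ t₃ t₄ t₅ t₀ t₁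
  no-6-cycle {line _ _ _} {line _ _ _} {line _ _ _} t₀ _ _ _ _ _ = no-line-path t₀

  girth≥7 : ∀ l → Cycle G l → 7 ≤ l
  girth≥7 (suc l) (cycle v 2≤l inj step close) = bound l 2≤l v inj step close
    where
    bound : ∀ l → 2 ≤ l → (v : Fin (suc l) → Fin order) → (∀ {i j} → v i ≡ v j → i ≡ j) →
            (∀ i → Adj G (v (inject₁ i)) (v (suc i))) → Adj G (v (fromℕ l)) (v zero) → 7 ≤ suc l
    bound l 2≤l v inj step close = short l ≡.refl 2≤l
      where
      turn-at : ∀ i j l → Adj G (v i) (v j) → Adj G (v j) (v l) → i ≢ l →
                Turn (decode (v i)) (decode (v j)) (decode (v l))
      turn-at i j l ij jl i≢l =
        turn (Adj⇒~ {v i} {v j} ij) (Adj⇒~ {v j} {v l} jl) (λ eq → i≢l (inj (decode-injective eq)))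
      short : ∀ n → n ≡ l → 2 ≤ n → 7 ≤ suc l
      short 1 _ (s≤s ())
      short 2 ≡.refl _ = contradiction
        (no-triangle (turn-at 0F 1F 2F (step 0F) (step 1F) λ ())
                     (turn-at 1F 2F 0F (step 1F) close     λ ())
                     (turn-at 2F 0F 1F close     (step 0F) λ ())) λ ()
      short 3 ≡.refl _ = contradiction
        (no-4-cycle (turn-at 0F 1F 2F (step 0F) (step 1F) λ ())
                    (turn-at 1F 2F 3F (step 1F) (step 2F) λ ())
                    (turn-at 2F 3F 0F (step 2F) close     λ ())
                    (turn-at 3F 0F 1F close     (step 0F) λ ())) λ ()
      short 4 ≡.refl _ = contradiction
        (no-5-cycle (turn-at 0F 1F 2F (step 0F) (step 1F) λ ())
                    (turn-at 1F 2F 3F (step 1F) (step 2F) λ ())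
                    (turn-at 2F 3F 4F (step 2F) (step 3F) λ ())
                    (turn-at 3F 4F 0F (step 3F) close     λ ())
                    (turn-at 4F 0F 1F close     (step 0F) λ ())) λ ()
      short 5 ≡.refl _ = contradiction
        (no-6-cycle (turn-at 0F 1F 2F (step 0F) (step 1F) λ ())
                    (turn-at 1F 2F 3F (step 1F) (step 2F) λ ())
                    (turn-at 2F 3F 4F (step 2F) (step 3F) λ ())
                    (turn-at 3F 4F 5F (step 3F) (step 4F) λ ())
                    (turn-at 4F 5F 0F (step 4F) close     λ ())
                    (turn-at 5F 0F 1F close     (step 0F) λ ())) λ ()
      short (suc (suc (suc (suc (suc (suc n)))))) ≡.refl _ =
        s≤s (s≤s (s≤s (s≤s (s≤s (s≤s (s≤s z≤n))))))

  -- A cycle of length seven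

  apex : ∀ x y → ¬ (x ≡ zero × y ≡ zero) → Fin pairs
  apex x y nonzero = proj₁ (locate x y nonzero)

  apex-incident : ∀ x y nonzero {z j u w} → ⟦ y ⟧ + ⟦ u ⟧ ≈ slope x * slope j →
                  ⟦ z ⟧ + ⟦ w ⟧ ≈ slope x * ⟦ u ⟧ → Incident (apex x y nonzero) z j u w
  apex-incident x y nonzero eq₁ eq₂ with locate x y nonzero
  ... | c , ≡.refl , ≡.refl = incident eq₁ eq₂

  -- Tells the vertices of the seven-cycle apart by computation: their coordinate indices, all at
  -- most 2, are read as base-three digits, and lines are shifted by 27.
  label : Vertex → ℕ
  label (point c z)  = toℕ (col c) ℕ.* 9 ℕ.+ (toℕ (row c) ℕ.* 3 ℕ.+ toℕ z)
  label (line j u w) = 27 ℕ.+ (toℕ j ℕ.* 9 ℕ.+ (toℕ u ℕ.* 3 ℕ.+ toℕ w))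

  label-apex : ∀ x y nonzero z →
               label (point (apex x y nonzero) z) ≡ toℕ x ℕ.* 9 ℕ.+ (toℕ y ℕ.* 3 ℕ.+ toℕ z)
  label-apex x y nonzero z with locate x y nonzero
  ... | c , ≡.refl , ≡.refl = ≡.refl

  -- The labels along `heptagon`, where n is the index of -1, that is 2, or 1 in characteristic two.
  labels : ℕ → Vec ℕ 7
  labels n = 27 ∷ 36 ∷ 12 ∷ 27 ℕ.+ (n ℕ.* 3 ℕ.+ n) ∷ 4 ∷ 27 ℕ.+ (n ℕ.* 9 ℕ.+ (n ℕ.* 3 ℕ.+ n)) ∷ 9 ∷ []

  Distinct : ℕ → Set
  Distinct n = ∀ i j → lookup (labels n) i ≡ lookup (labels n) j → i ≡ j

  distinct? : ∀ n → Dec (Distinct n)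
  distinct? n = Fin.all? λ i → Fin.all? λ j →
    (lookup (labels n) i ℕ.≟ lookup (labels n) j) →-dec (i Fin.≟ j)

  -- With ⟦ n ⟧ ≈ −1, the lines [0,0,0] and [1,0,0], which are matched, are joined by
  -- [0,0,0] – (1,0,0) – [−1,−1,−1] – (0,1,1) – [0,−1,−1] – (1,1,0) – [1,0,0].
  heptagon : ∀ (n : Fin k) (n′ : Fin q) (l : ℕ) → slope n ≈ - 1# → ⟦ n′ ⟧ ≈ - 1# →
             toℕ n ≡ l → toℕ n′ ≡ l →
             Distinct l → Cycle G 7
  heptagon n n′ l slope-n ⟦n′⟧ toℕn toℕn′ labels-distinct =
    cycle (encode ∘ vertex) (s≤s (s≤s z≤n))
      (λ {i} {j} eq → labels-distinct i j
        (≡.trans (≡.sym (labelled i)) (≡.trans (cong label (encode-injective {vertex i} {vertex j} eq)) (labelled j))))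
      (λ i → ~⇒Adj {vertex (inject₁ i)} {vertex (suc i)} (step i))
      (~⇒Adj {vertex 6F} {vertex 0F} (apex-incident 1F 0F nonzero₁₀
        (trans (+-cong ⟦0⟧ ⟦0⟧) (trans (+-identityˡ 0#) (sym (trans (*-congˡ slope-0) (zeroʳ _)))))
        (trans (+-cong ⟦0⟧ ⟦0⟧) (trans (+-identityˡ 0#) (sym (trans (*-congˡ ⟦0⟧) (zeroʳ _)))))))
    where
    nonzero₁₁ : ¬ (_≡_ {A = Fin k} 1F zero × _≡_ {A = Fin q} 1F zero)
    nonzero₁₁ ()
    nonzero₀₁ : ¬ (_≡_ {A = Fin k} 0F zero × _≡_ {A = Fin q} 1F zero)
    nonzero₀₁ ()
    nonzero₁₀ : ¬ (_≡_ {A = Fin k} 1F zero × _≡_ {A = Fin q} 0F zero)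
    nonzero₁₀ ()

    vertex : Fin 7 → Vertex
    vertex 0F = line 0F 0F 0F
    vertex 1F = line 1F 0F 0F
    vertex 2F = point (apex 1F 1F nonzero₁₁) 0F
    vertex 3F = line 0F n′ n′
    vertex 4F = point (apex 0F 1F nonzero₀₁) 1F
    vertex 5F = line n n′ n′
    vertex 6F = point (apex 1F 0F nonzero₁₀) 0F

    labelled : ∀ i → label (vertex i) ≡ lookup (labels l) i
    labelled 0F = ≡.refl
    labelled 1F = ≡.refl
    labelled 2F = label-apex 1F 1F nonzero₁₁ 0F
    labelled 3F rewrite toℕn′ = ≡.refl
    labelled 4F = label-apex 0F 1F nonzero₀₁ 1F
    labelled 5F rewrite toℕn | toℕn′ = ≡.refl
    labelled 6F = label-apex 1F 0F nonzero₁₀ 0F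

    -1+1 : 1# + - 1# ≈ 0#
    -1+1 = -‿inverseʳ 1#

    step : ∀ i → vertex (inject₁ i) ~ vertex (suc i)
    step 0F = (≡.refl , ≡.refl) , ≡.refl , ≡.refl
    step 1F = apex-incident 1F 1F nonzero₁₁
      (trans (+-cong ⟦1⟧ ⟦0⟧) (trans (+-identityʳ 1#) (sym (trans (*-cong ⟦1⟧ ⟦1⟧) (*-identityˡ 1#)))))
      (trans (+-cong ⟦0⟧ ⟦0⟧) (trans (+-identityˡ 0#) (sym (trans (*-congˡ ⟦0⟧) (zeroʳ _)))))
    step 2F = apex-incident 1F 1F nonzero₁₁
      (trans (+-cong ⟦1⟧ ⟦n′⟧) (trans -1+1 (sym (trans (*-congˡ slope-0) (zeroʳ _)))))
      (trans (+-congʳ ⟦0⟧) (trans (+-identityˡ _) (sym (trans (*-congʳ ⟦1⟧) (*-identityˡ _)))))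
    step 3F = apex-incident 0F 1F nonzero₀₁
      (trans (+-cong ⟦1⟧ ⟦n′⟧) (trans -1+1 (sym (trans (*-congˡ slope-0) (zeroʳ _)))))
      (trans (+-cong ⟦1⟧ ⟦n′⟧) (trans -1+1 (sym (trans (*-congʳ slope-0) (zeroˡ _)))))
    step 4F = apex-incident 0F 1F nonzero₀₁
      (trans (+-cong ⟦1⟧ ⟦n′⟧) (trans -1+1 (sym (trans (*-congʳ slope-0) (zeroˡ _)))))
      (trans (+-cong ⟦1⟧ ⟦n′⟧) (trans -1+1 (sym (trans (*-congʳ slope-0) (zeroˡ _)))))
    step 5F = apex-incident 1F 0F nonzero₁₀
      (trans (+-cong ⟦0⟧ ⟦n′⟧) (trans (+-identityˡ _) (sym (trans (*-cong ⟦1⟧ slope-n) (*-identityˡ _)))))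
      (trans (+-congʳ ⟦0⟧) (trans (+-identityˡ _) (sym (trans (*-congʳ ⟦1⟧) (*-identityˡ _)))))

  cycle-7 : Cycle G 7
  cycle-7 with ⟦2⟧
  ... | inj₁ ⟦2⟧≈-1 = heptagon 2F 2F 2 ⟦2⟧≈-1 ⟦2⟧≈-1 ≡.refl ≡.refl
    (from-yes (distinct? 2))
  ... | inj₂ 1≈-1   = heptagon 1F 1F 1 (trans ⟦1⟧ 1≈-1) (trans ⟦1⟧ 1≈-1) ≡.refl ≡.refl
    (from-yes (distinct? 1))

  construction : Is[ k , 7 ]-graph G
  construction = record { regular = regular neighbourhood ; girth = cycle-7 , girth≥7 }

-- The order of the graph and the bounds

open import Data.Nat using (_+_; _*_; _^_)

-- Adding `suc q` removes the truncated subtraction, and the predecessor of the product computes to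
-- `q + k * suc q`, the form handed to the solver.
order-value : ∀ k q → pred (suc k * suc q) * suc q + suc k * (suc q * suc q) ≡ 2 * suc k * suc q ^ 2 ∸ suc q
order-value k q = ≡.trans (≡.sym (ℕ.m+n∸n≡m _ (suc q))) (cong (_∸ suc q)
  (solve 2 (λ k q → (q :+ k :* (con 1 :+ q)) :* (con 1 :+ q) :+ (con 1 :+ k) :* ((con 1 :+ q) :* (con 1 :+ q)) :+ (con 1 :+ q)
    := con 2 :* (con 1 :+ k) :* (con 1 :+ q) :^ 2) ≡.refl k q))
  where open +-*-Solver

-- Stated for every prime power q ≥ k, so that it also serves k = q - 1. The cases k < 4 and q < 3
-- are contradictory; the rest has the form k = (2 + m) * 2 and q = 3 + r.
order-bound : ∀ k q → 4 ≤ k → 2 ∣ k → IsPrimePower q → k ≤ q →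
              ∃[ n ] (IsMinOrder k 7 n × n ≤ 2 * k * q ^ 2 ∸ q)
order-bound _ q () (divides 0 ≡.refl) _ _
order-bound _ q (s≤s (s≤s ())) (divides 1 ≡.refl) _ _
order-bound _ 1 _ (divides (suc (suc m)) ≡.refl) _ (s≤s ())
order-bound _ 2 _ (divides (suc (suc m)) ≡.refl) _ (s≤s (s≤s ()))
order-bound k (suc (suc (suc r))) _ (divides (suc (suc m)) ≡.refl) prime-power k≤q =
  let n , minimal , n≤ =
        min-order k 7 (Construction.construction (coordinates (finite-field prime-power)) m k≤q)
  in n , minimal , ℕ.≤-trans n≤ (ℕ.≤-reflexive (order-value (pred k) (2 + r)))

odd⇒2∣pred : ∀ q → ¬ 2 ∣ suc q → 2 ∣ q
odd⇒2∣pred q odd with q % 2 in eq | m%n<n q 2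
... | 0           | _ = m%n≡0⇒n∣m q 2 eq
... | 1           | _ = contradiction (divides (suc (q / 2)) (cong suc (≡.trans (m≡m%n+[m/n]*n q 2) (cong (_+ q / 2 * 2) eq)))) odd
... | suc (suc _) | s≤s (s≤s ())

cubic : ∀ x → 2 * x * suc x ^ 2 ≡ 2 * suc x ^ 3 ∸ 2 * suc x ^ 2
cubic x = ≡.trans (≡.sym (ℕ.m+n∸n≡m _ (2 * suc x ^ 2))) (cong (_∸ 2 * suc x ^ 2)
  (solve 1 (λ x → con 2 :* x :* (con 1 :+ x) :^ 2 :+ con 2 :* (con 1 :+ x) :^ 2 := con 2 :* (con 1 :+ x) :^ 3) ≡.refl x))
  where open +-*-Solver

-- With q = x + 2, the expansion in powers of q - 1 has a summand q, which the subtraction cancels.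
expansion : ∀ x → 2 * suc x * suc (suc x) ^ 2 ∸ suc (suc x) ≡ 2 * suc x ^ 3 + 4 * suc x ^ 2 + suc x ∸ 1
expansion x = begin
  2 * suc x * suc (suc x) ^ 2 ∸ suc (suc x)
    ≡⟨ cong (_∸ suc (suc x)) (solve 1 (λ x → con 2 :* (con 1 :+ x) :* (con 2 :+ x) :^ 2
         := con 2 :* (con 1 :+ x) :^ 3 :+ con 4 :* (con 1 :+ x) :^ 2 :+ x :+ (con 2 :+ x)) ≡.refl x) ⟩
  2 * suc x ^ 3 + 4 * suc x ^ 2 + x + suc (suc x) ∸ suc (suc x)
    ≡⟨ ℕ.m+n∸n≡m _ (suc (suc x)) ⟩
  2 * suc x ^ 3 + 4 * suc x ^ 2 + x
    ≡⟨ cong (_∸ 1) (ℕ.+-suc (2 * suc x ^ 3 + 4 * suc x ^ 2) x) ⟨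
  2 * suc x ^ 3 + 4 * suc x ^ 2 + suc x ∸ 1 ∎
  where
  open ≡.≡-Reasoning
  open +-*-Solver

theorem10 : (∀ (k q : ℕ) → 4 ≤ k → 2 ∣ k →
    IsLeast (λ r → IsPrimePower r × k ≤ r) q →
    ∃[ n ] (IsMinOrder k 7 n × n ≤ 2 * k * q ^ 2 ∸ q))
    ×
    (∀ (q : ℕ) → IsPrimePower q → ¬ (2 ∣ q) → 4 ≤ q ∸ 1 →
    (∃[ n ] (IsMinOrder (q ∸ 1) 7 n × n ≤ 2 * q ^ 3 ∸ 2 * q ^ 2 ∸ q))
    ×
    2 * q ^ 3 ∸ 2 * q ^ 2 ∸ q ≡ 2 * (q ∸ 1) ^ 3 + 4 * (q ∸ 1) ^ 2 + (q ∸ 1) ∸ 1)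
theorem10 =
  (λ { k q 4≤k 2∣k ((prime-power , k≤q) , _) → order-bound k q 4≤k 2∣k prime-power k≤q }) ,
  λ { (suc (suc x)) prime-power odd 4≤q-1 →
      -- Here k = q - 1, which is even because q is odd, and q is itself a prime power not below k.
      let n , minimal , n≤ = order-bound (suc x) (suc (suc x)) 4≤q-1 (odd⇒2∣pred (suc x) odd)
                                         prime-power (ℕ.n≤1+n (suc x))
      in (n , minimal , subst (n ≤_) (cong (_∸ suc (suc x)) (cubic (suc x))) n≤)
       , ≡.trans (cong (_∸ suc (suc x)) (≡.sym (cubic (suc x)))) (expansion x) }
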